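{- For any constant $\epsilon>0$, there is a polynomial-time $\left(\frac16-\epsilon\right)$-approximation algorithm for maximizing any non-negative submodular function over bases of a matroid $\mathcal{M}$, when $\mathcal{M}$ contains at least two disjoint bases; that is, given a matroid $\mathcal{M}$ on a finite ground set $V$ having two disjoint bases and a non-negative submodular function $f:2^V\to\mathbb{R}_{\ge0}$, the algorithm returns a base $S\in\mathcal{B}(\mathcal{M})$ with $$f(S)\ \ge\ \left(\tfrac16-\epsilon\right)\cdot\max\{f(T)\ :\ T\in\mathcal{B}(\mathcal{M})\}.$$
   Context: A function $f:2^V\to\mathbb{R}$ is submodular if $f(S\cup T)+f(S\cap T)\le f(S)+f(T)$ for all $S,T\subseteq V$ (it need not be monotone). $\mathcal{B}(\mathcal{M})$ denotes the set of bases (maximal independent sets) of $\mathcal{M}$. The function $f$ is accessed through a value oracle (given $S$, returns $f(S)$) and the matroid through an independence oracle; oracle calls count as single steps, and polynomial time means polynomial in the input size for fixed $\epsilon$. -}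

module Defs where

open import Algebra.Bundles using (CommutativeRing)
import Algebra.Definitions.RawMonoid as RawMonoidDefinitions
open import Data.Bool.Base using (Bool; true; false; not; if_then_else_)
open import Data.Fin.Base using (fromℕ<)
open import Data.Fin.Subset using
  (Subset; Side; inside; outside; ⊥; ⁅_⁆; _∈_; _∉_; _⊆_; _∪_; _∩_; ∣_∣; Empty)
open import Data.Nat.Base as ℕ using (ℕ; zero; suc)
import Data.Nat.Properties as ℕ
open import Data.Product.Base using (∃; ∃-syntax; _×_; _,_)
open import Data.Vec.Base using (lookup; _[_]≔_)
open import Level using (0ℓ)
open import Relation.Binary.PropositionalEquality.Core using (_≡_)
open import Relation.Binary.Structures using (IsDecTotalOrder)
open import Relation.Nullary using (¬_; yes; no; does)
open import Relation.Unary using (Pred; Decidable)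

-- The real numbers, axiomatised as a Dedekind-complete ordered field.
-- The order is decidable, as in the classical reals.  The inverse is total;
-- nothing is assumed about the inverse of 0.

record Reals : Set₁ where
  infix  8 _⁻¹
  infix  4 _≤_ _<_ _≉_
  field
    commutativeRing : CommutativeRing 0ℓ 0ℓ

  open CommutativeRing commutativeRing public
    using (_≈_; _+_; _*_; -_; _-_; 0#; 1#; +-rawMonoid)
    renaming (Carrier to ℝ)

  _≉_ : ℝ → ℝ → Set
  x ≉ y = ¬ (x ≈ y)

  field
    _⁻¹             : ℝ → ℝ
    1≉0             : 1# ≉ 0#
    ⁻¹-inverse      : ∀ x → x ≉ 0# → x * x ⁻¹ ≈ 1#
    _≤_             : ℝ → ℝ → Set
    isDecTotalOrder : IsDecTotalOrder _≈_ _≤_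
    +-monoˡ-≤       : ∀ z {x y} → x ≤ y → x + z ≤ y + z
    *-nonNegative   : ∀ {x y} → 0# ≤ x → 0# ≤ y → 0# ≤ x * y

  open IsDecTotalOrder isDecTotalOrder public using (_≤?_)

  _<_ : ℝ → ℝ → Set
  x < y = ¬ (y ≤ x)

  -- "s is the least upper bound of P" in its positive form: no y < s is an
  -- upper bound, because some member of P exceeds it.
  IsSupremum : Pred ℝ 0ℓ → ℝ → Set
  IsSupremum P s = (∀ x → P x → x ≤ s) × (∀ y → y < s → ∃[ x ] P x × y < x)

  field
    complete : ∀ (P : Pred ℝ 0ℓ) → ∃ P → (∃[ b ] ∀ x → P x → x ≤ b) →
               ∃ (IsSupremum P)

  open RawMonoidDefinitions +-rawMonoid using () renaming (_×_ to _·_)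

  fromℕ : ℕ → ℝ
  fromℕ k = k · 1#

-- Matroids on the ground set Fin n, by independent sets.

record Matroid (n : ℕ) : Set₁ where
  field
    Indep      : Pred (Subset n) 0ℓ
    indep?     : Decidable Indep
    ⊥-indep    : Indep ⊥
    hereditary : ∀ {S T} → S ⊆ T → Indep T → Indep S
    exchange   : ∀ {S T} → Indep S → Indep T → ∣ S ∣ ℕ.< ∣ T ∣ →
                 ∃[ x ] x ∈ T × x ∉ S × Indep (S ∪ ⁅ x ⁆)

  IsBase : Pred (Subset n) 0ℓ
  IsBase S = Indep S × (∀ T → Indep T → S ⊆ T → T ≡ S)

  HasTwoDisjointBases : Set
  HasTwoDisjointBases = ∃[ A ] ∃[ B ] IsBase A × IsBase B × Empty (A ∩ B)

module SetFunctions (R : Reals) {n : ℕ} where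
  open Reals R

  Submodular : (Subset n → ℝ) → Set
  Submodular f = ∀ S T → f (S ∪ T) + f (S ∩ T) ≤ f S + f T

  NonNegative : (Subset n → ℝ) → Set
  NonNegative f = ∀ S → 0# ≤ f S

  IsMaximumOver : Pred (Subset n) 0ℓ → (Subset n → ℝ) → ℝ → Set
  IsMaximumOver P f m = (∃[ T ] P T × f T ≈ m) × (∀ T → P T → f T ≤ m)

-- Algorithms are programs of a random access machine whose memory consists of
-- three unbounded arrays, holding natural numbers, real numbers and subsets of
-- the ground set.  A program is a finite piece of syntax that does not mention
-- n, the matroid or the function: it learns n from its input and the rest only
-- through the two oracles.
--
-- Every instruction and every test takes one step.  Multiplication is left out
-- (of naturals, as is usual for unit-cost machines, and of reals), because
-- repeated squaring would produce numbers of exponential bit length in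
-- polynomially many steps.  For the same reason the only real literals are 0
-- and 1, so that no information can be hidden in the digits of a constant.

data Address : Set where
  direct   : ℕ → Address
  indirect : ℕ → Address    -- the address stored in that natural register

data Instruction : Set where
  constℕ      : Address → ℕ → Instruction
  copyℕ       : Address → Address → Instruction
  addℕ monusℕ : Address → Address → Address → Instruction
  zeroℝ oneℝ  : Address → Instruction
  copyℝ       : Address → Address → Instruction
  addℝ subℝ   : Address → Address → Address → Instruction
  emptyS      : Address → Instruction
  copyS       : Address → Address → Instruction
  -- The second address is a natural register holding the number of an element.
  insertS     : Address → Address → Instruction
  removeS     : Address → Address → Instruction
  -- The value oracle: store f(S) in a real register, S being in a set register.
  value       : Address → Address → Instruction

data Test : Set where
  leqℕ leqℝ : Address → Address → Test
  memberS   : Address → Address → Test    -- set register, natural register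
  indepS    : Address → Test              -- the independence oracle
  negate    : Test → Test

infixr 5 _⨾_

data Program : Set where
  skip    : Program
  do′     : Instruction → Program
  _⨾_     : Program → Program → Program
  if′     : Test → Program → Program → Program
  while′  : Test → Program → Program

module Machine (R : Reals) {n : ℕ} where
  open Reals R using (ℝ; 0#; 1#; _+_; _-_; _≤?_)

  record State : Set where
    constructor ⟪_,_,_⟫
    field
      nats  : ℕ → ℕ
      reals : ℕ → ℝ
      sets  : ℕ → Subset n
  open State public

  infixl 9 _[_↦_]

  _[_↦_] : {A : Set} → (ℕ → A) → ℕ → A → (ℕ → A)
  (m [ k ↦ v ]) j = if j ℕ.≡ᵇ k then v else m j

  -- Numbers i ≥ n name no element: they are never members, and inserting or
  -- removing them has no effect.
  put : ℕ → Side → Subset n → Subset n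
  put i b S with i ℕ.<? n
  ... | yes i<n = S [ fromℕ< i<n ]≔ b
  ... | no  _   = S

  get : ℕ → Subset n → Bool
  get i S with i ℕ.<? n
  ... | yes i<n = lookup S (fromℕ< i<n)
  ... | no  _   = false

  address : State → Address → ℕ
  address σ (direct k)   = k
  address σ (indirect k) = nats σ k

  nat : State → Address → ℕ
  nat σ a = nats σ (address σ a)

  real : State → Address → ℝ
  real σ a = reals σ (address σ a)

  set : State → Address → Subset n
  set σ a = sets σ (address σ a)

  setNat : State → Address → ℕ → State
  setNat σ a v = record σ { nats = nats σ [ address σ a ↦ v ] }

  setReal : State → Address → ℝ → State
  setReal σ a v = record σ { reals = reals σ [ address σ a ↦ v ] }

  setSet : State → Address → Subset n → State
  setSet σ a v = record σ { sets = sets σ [ address σ a ↦ v ] }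

  initial : State
  initial = ⟪ (λ _ → 0) [ 0 ↦ n ] , (λ _ → 0#) , (λ _ → ⊥) ⟫

  module Semantics (M : Matroid n) (f : Subset n → ℝ) where
    open Matroid M using (indep?)

    execute : Instruction → State → State
    execute (constℕ a k)   σ = setNat  σ a k
    execute (copyℕ a b)    σ = setNat  σ a (nat σ b)
    execute (addℕ a b c)   σ = setNat  σ a (nat σ b ℕ.+ nat σ c)
    execute (monusℕ a b c) σ = setNat  σ a (nat σ b ℕ.∸ nat σ c)
    execute (zeroℝ a)      σ = setReal σ a 0#
    execute (oneℝ a)       σ = setReal σ a 1#
    execute (copyℝ a b)    σ = setReal σ a (real σ b)
    execute (addℝ a b c)   σ = setReal σ a (real σ b + real σ c)
    execute (subℝ a b c)   σ = setReal σ a (real σ b - real σ c)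
    execute (emptyS a)     σ = setSet  σ a ⊥
    execute (copyS a b)    σ = setSet  σ a (set σ b)
    execute (insertS a i)  σ = setSet  σ a (put (nat σ i) inside  (set σ a))
    execute (removeS a i)  σ = setSet  σ a (put (nat σ i) outside (set σ a))
    execute (value a b)    σ = setReal σ a (f (set σ b))

    test : Test → State → Bool
    test (leqℕ a b)    σ = nat σ a ℕ.≤ᵇ nat σ b
    test (leqℝ a b)    σ = does (real σ a ≤? real σ b)
    test (memberS a i) σ = get (nat σ i) (set σ a)
    test (indepS a)    σ = does (indep? (set σ a))
    test (negate c)    σ = not (test c σ)

    infix 4 ⟨_,_⟩⇓[_]_

    -- ⟨ p , σ ⟩⇓[ t ] τ : started in σ, p halts in τ after t steps.
    data ⟨_,_⟩⇓[_]_ : Program → State → ℕ → State → Set where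
      skip        : ∀ {σ} → ⟨ skip , σ ⟩⇓[ 1 ] σ
      do′         : ∀ {i σ} → ⟨ do′ i , σ ⟩⇓[ 1 ] execute i σ
      _⨾_         : ∀ {p q σ τ υ s t} →
                    ⟨ p , σ ⟩⇓[ s ] τ → ⟨ q , τ ⟩⇓[ t ] υ →
                    ⟨ p ⨾ q , σ ⟩⇓[ s ℕ.+ t ] υ
      if-true     : ∀ {c p q σ τ t} → test c σ ≡ true →
                    ⟨ p , σ ⟩⇓[ t ] τ → ⟨ if′ c p q , σ ⟩⇓[ suc t ] τ
      if-false    : ∀ {c p q σ τ t} → test c σ ≡ false →
                    ⟨ q , σ ⟩⇓[ t ] τ → ⟨ if′ c p q , σ ⟩⇓[ suc t ] τ
      while-true  : ∀ {c p σ τ υ s t} → test c σ ≡ true →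
                    ⟨ p , σ ⟩⇓[ s ] τ → ⟨ while′ c p , τ ⟩⇓[ t ] υ →
                    ⟨ while′ c p , σ ⟩⇓[ suc (s ℕ.+ t) ] υ
      while-false : ∀ {c p σ} → test c σ ≡ false →
                    ⟨ while′ c p , σ ⟩⇓[ 1 ] σ

    -- The input n is in natural register 0, the output in set register 0.
    Returns : Program → Subset n → ℕ → Set
    Returns p S t = ∃[ τ ] (⟨ p , initial ⟩⇓[ t ] τ) × sets τ 0 ≡ S

PolynomiallyBounded : (ℕ → ℕ) → Set
PolynomiallyBounded T = ∃[ a ] ∃[ k ] ∀ n → T n ℕ.≤ a ℕ.* suc n ℕ.^ k

module _ (R : Reals) where
  open Reals R
  open SetFunctions R
  open Machine R

  -- One program and one polynomial serve all ground sets, matroids and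
  -- functions.
  PolyTimeApproximation : ℝ → Program → Set₁
  PolyTimeApproximation α p =
    ∃[ T ] PolynomiallyBounded T ×
    (∀ {n} (M : Matroid n) (f : Subset n → ℝ) →
     Matroid.HasTwoDisjointBases M → NonNegative f → Submodular f →
     ∃[ S ] ∃[ t ] Semantics.Returns M f p S t × t ℕ.≤ T n ×
       Matroid.IsBase M S ×
       (∀ m → IsMaximumOver (Matroid.IsBase M) f m → α * m ≤ f S))

{-# OPTIONS --safe #-}
module Submission where

open import Defs
open import Algebra.Bundles using (CommutativeRing)
import Algebra.Definitions.RawMonoid as RawMonoidDefinitions
import Algebra.Properties.Semiring.Mult as SemiringMult
import Algebra.Solver.Ring.NaturalCoefficients.Default as RingSolver
open import Data.Bool.Base using (Bool; true; false; _∧_; _∨_; not; if_then_else_)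
open import Data.Bool.Properties using (T-≡; T-∧)
open import Data.Fin.Base using (Fin; zero; suc; toℕ)
open import Data.Fin.Properties using (toℕ<n; fromℕ<-toℕ)
open import Data.Fin.Subset hiding (_-_; ⊤; _⊂_)
open import Data.Fin.Subset.Properties
open import Data.List.Base using (List; []; _∷_)
open import Data.List.Relation.Unary.All using (All; []; _∷_)
open import Data.Nat.Base as ℕ using (ℕ; zero; suc)
import Data.Nat.Properties as ℕ
open import Data.Product using (∃-syntax; _×_; _,_; proj₁; proj₂)
open import Data.Sum.Base using (_⊎_; inj₁; inj₂; [_,_]′)
open import Data.Vec.Base as Vec using (Vec; []; _∷_; lookup; tabulate; _[_]≔_)
open import Data.Vec.Functional as Vector using (Vector; foldl)
open import Data.Vec.Properties
  using ([]=⇒lookup; lookup⇒[]=; lookup-zipWith; lookup-map; lookup-replicate; lookup∘tabulate)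
open import Data.Unit.Base using (tt)
open import Function.Bundles using (module Equivalence)
open import Level using (0ℓ)
open import Relation.Binary.Bundles using (Poset)
open import Relation.Binary.PropositionalEquality as ≡
  using (_≡_; _≢_; refl; sym; trans; cong; cong₂; subst; subst₂)
import Relation.Binary.Reasoning.PartialOrder as PosetReasoning
open import Relation.Binary.Structures using (IsDecTotalOrder)
open import Relation.Nullary using (¬_; Dec; yes; no; does; contradiction)
open import Relation.Nullary.Decidable using (_×-dec_)
open import Relation.Unary using (Pred; Decidable)

-- The algorithm is a local search over bases that swaps one element for
-- another.  A base X containing K at which no swap increases a submodular h
-- satisfies 2 h(X) ≥ h(X ∪ C) + h(X ∩ C), up to a small error, for every base
-- C ⊇ K.  Let S be locally optimal for f, T for f(· ─ S), and X ⊇ K = T ─ S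
-- for f.  The first two give 2 f(S) + 2 f(K) ≥ f(C) for every base C, as in the
-- case of independent sets.  For the third, the union of a matroid with itself
-- is a matroid, so X is covered by two bases P, Q with P ∩ Q = K; adding up
-- the inequalities for C = P and C = Q leaves 2 f(X) ≥ f(K).  Together these
-- are 6 max (f(S), f(X)) ≥ f(C).  No pair of disjoint bases is ever computed.
--
-- Swaps are made when they gain more than w / (k n²), where w, the sum of f(∅)
-- and all f({v}) with {v} independent, bounds f on independent sets and is at
-- most 2 (n + 1) times the optimum.

-- The obstacle is that `f` is not monotone: `K = T ─ S` carries the value that the second search
-- finds, but it is only independent, and a base containing it may be worth far less. Two bases that
-- meet exactly in `K` cannot both be bad, since submodularity and non-negativity give f(P ∩ Q) ≤
-- f(P) + f(Q). The search with `K` frozen attains the guarantee of the better of `P` and `Q`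
-- without finding either. The factor 6 is 2 + 2 · 2: f(C) ≤ 2 f(S) + 2 f(K) and f(K) ≤ 2 f(X). The
-- error adds up as follows, `m` being the optimum. Comparing a local optimum with a base takes at
-- most n exchanges, each losing at most w / (k n²), and w ≤ 2 (n + 1) m, so one comparison loses at
-- most 4 m / k. Six such losses enter the final bound, and `k` is chosen with 4 ≤ k ε, which makes
-- them at most 6 ε m. The machine neither multiplies nor divides reals, so objectives are compared
-- after being added up k n² times. The same number of sweeps is enough to reach a local optimum.

-- Inclusions between Boolean combinations of subsets that follow from other
-- such inclusions are decided by truth tables, one element at a time.
module SetSolver where
  open import Data.Bool.Base using (T)

  infixl 6 _⊔_ _⊓_ _∖_
  infix  4 _⊑_

  data Expr (k : ℕ) : Set where
    var         : Fin k → Expr k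
    ø           : Expr k
    _⊔_ _⊓_ _∖_ : Expr k → Expr k → Expr k

  record Inclusion (k : ℕ) : Set where
    constructor _⊑_
    field smaller larger : Expr k

  ⟦_⟧ : ∀ {k n} → Expr k → Vec (Subset n) k → Subset n
  ⟦ var i ⟧ ρ = lookup ρ i
  ⟦ ø ⟧     ρ = ⊥
  ⟦ d ⊔ e ⟧ ρ = ⟦ d ⟧ ρ ∪ ⟦ e ⟧ ρ
  ⟦ d ⊓ e ⟧ ρ = ⟦ d ⟧ ρ ∩ ⟦ e ⟧ ρ
  ⟦ d ∖ e ⟧ ρ = ⟦ d ⟧ ρ ─ ⟦ e ⟧ ρ

  bit : ∀ {k} → Expr k → Vec Bool k → Bool
  bit (var i) bs = lookup bs i
  bit ø       bs = false
  bit (d ⊔ e) bs = bit d bs ∨ bit e bs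
  bit (d ⊓ e) bs = bit d bs ∧ bit e bs
  bit (d ∖ e) bs = bit d bs ∧ not (bit e bs)

  lookup-─ : ∀ {n} (i : Fin n) (p q : Subset n) →
             lookup (p ─ q) i ≡ lookup p i ∧ not (lookup q i)
  lookup-─ zero    (true  ∷ p) (true  ∷ q) = refl
  lookup-─ zero    (true  ∷ p) (false ∷ q) = refl
  lookup-─ zero    (false ∷ p) (true  ∷ q) = refl
  lookup-─ zero    (false ∷ p) (false ∷ q) = refl
  lookup-─ (suc i) (_ ∷ p)     (_ ∷ q)     = lookup-─ i p q

  lookup-⟦⟧ : ∀ {k n} (e : Expr k) (ρ : Vec (Subset n) k) (i : Fin n) →
              lookup (⟦ e ⟧ ρ) i ≡ bit e (Vec.map (λ S → lookup S i) ρ)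
  lookup-⟦⟧ (var j) ρ i = sym (lookup-map j _ ρ)
  lookup-⟦⟧ ø       ρ i = lookup-replicate i false
  lookup-⟦⟧ (d ⊔ e) ρ i = trans (lookup-zipWith _∨_ i (⟦ d ⟧ ρ) (⟦ e ⟧ ρ))
                                (cong₂ _∨_ (lookup-⟦⟧ d ρ i) (lookup-⟦⟧ e ρ i))
  lookup-⟦⟧ (d ⊓ e) ρ i = trans (lookup-zipWith _∧_ i (⟦ d ⟧ ρ) (⟦ e ⟧ ρ))
                                (cong₂ _∧_ (lookup-⟦⟧ d ρ i) (lookup-⟦⟧ e ρ i))
  lookup-⟦⟧ (d ∖ e) ρ i = trans (lookup-─ i (⟦ d ⟧ ρ) (⟦ e ⟧ ρ))
                                (cong₂ (λ a b → a ∧ not b) (lookup-⟦⟧ d ρ i) (lookup-⟦⟧ e ρ i))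

  Holds : ∀ {k n} → Vec (Subset n) k → Inclusion k → Set
  Holds ρ (d ⊑ e) = ⟦ d ⟧ ρ ⊆ ⟦ e ⟧ ρ

  infixr 5 _⇒_
  _⇒_ : Bool → Bool → Bool
  a ⇒ b = not a ∨ b

  entails : ∀ {k} → List (Inclusion k) → Inclusion k → Vec Bool k → Bool
  entails []             (d ⊑ e) bs = bit d bs ⇒ bit e bs
  entails ((a ⊑ b) ∷ hs) c       bs = (bit a bs ⇒ bit b bs) ⇒ entails hs c bs

  tautology : ∀ k → (Vec Bool k → Bool) → Bool
  tautology zero    φ = φ []
  tautology (suc k) φ = tautology k (λ bs → φ (true ∷ bs)) ∧ tautology k (λ bs → φ (false ∷ bs))

  tautology-sound : ∀ {k} φ → T (tautology k φ) → ∀ bs → T (φ bs)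
  tautology-sound φ t []           = t
  tautology-sound φ t (true  ∷ bs) = tautology-sound _ (proj₁ (Equivalence.to T-∧ t)) bs
  tautology-sound φ t (false ∷ bs) = tautology-sound _ (proj₂ (Equivalence.to T-∧ t)) bs

  ⇒-intro : ∀ a b → (T a → T b) → T (a ⇒ b)
  ⇒-intro true  b f = f tt
  ⇒-intro false b f = tt

  ⇒-elim : ∀ a {b} → T (a ⇒ b) → T a → T b
  ⇒-elim true t _ = t

  module _ {k n} (ρ : Vec (Subset n) k) (i : Fin n) where
    private bs = Vec.map (λ S → lookup S i) ρ

    ∈⇒bit : ∀ e → i ∈ ⟦ e ⟧ ρ → T (bit e bs)
    ∈⇒bit e i∈ = Equivalence.from T-≡ (trans (sym (lookup-⟦⟧ e ρ i)) ([]=⇒lookup i∈))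

    bit⇒∈ : ∀ e → T (bit e bs) → i ∈ ⟦ e ⟧ ρ
    bit⇒∈ e t = lookup⇒[]= i (⟦ e ⟧ ρ) (trans (lookup-⟦⟧ e ρ i) (Equivalence.to T-≡ t))

    entails-sound : ∀ hs d e → T (entails hs (d ⊑ e) bs) → All (Holds ρ) hs → i ∈ ⟦ d ⟧ ρ → i ∈ ⟦ e ⟧ ρ
    entails-sound []             d e t []       i∈d = bit⇒∈ e (⇒-elim (bit d bs) t (∈⇒bit d i∈d))
    entails-sound ((a ⊑ b) ∷ hs) d e t (h ∷ hh) =
      entails-sound hs d e
        (⇒-elim (bit a bs ⇒ bit b bs) t
          (⇒-intro (bit a bs) (bit b bs) (λ ta → ∈⇒bit b (h (bit⇒∈ a ta))))) hh

  -- The truth table is evaluated by the type checker: for concrete expressions the implicit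
  -- argument has the unit type and is filled in silently, whereas an invalid entailment would leave
  -- it at the empty type. The sets in `ρ` stay arbitrary.
  solve⊆ : ∀ {k n} (hs : List (Inclusion k)) (d e : Expr k) →
           {T (tautology k (entails hs (d ⊑ e)))} →
           (ρ : Vec (Subset n) k) → All (Holds ρ) hs → ⟦ d ⟧ ρ ⊆ ⟦ e ⟧ ρ
  solve⊆ hs d e {t} ρ hh {i} =
    entails-sound ρ i hs d e (tautology-sound (entails hs (d ⊑ e)) t _) hh

  solve≡ : ∀ {k n} (hs : List (Inclusion k)) (d e : Expr k) →
           {T (tautology k (entails hs (d ⊑ e)))} → {T (tautology k (entails hs (e ⊑ d)))} →
           (ρ : Vec (Subset n) k) → All (Holds ρ) hs → ⟦ d ⟧ ρ ≡ ⟦ e ⟧ ρ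
  solve≡ hs d e {t} {u} ρ hh = ⊆-antisym (solve⊆ hs d e {t} ρ hh) (solve⊆ hs e d {u} ρ hh)

  x₀ : ∀ {k} → Expr (1 ℕ.+ k)
  x₀ = var zero
  x₁ : ∀ {k} → Expr (2 ℕ.+ k)
  x₁ = var (suc zero)
  x₂ : ∀ {k} → Expr (3 ℕ.+ k)
  x₂ = var (suc (suc zero))
  x₃ : ∀ {k} → Expr (4 ℕ.+ k)
  x₃ = var (suc (suc (suc zero)))
  x₄ : ∀ {k} → Expr (5 ℕ.+ k)
  x₄ = var (suc (suc (suc (suc zero))))

open SetSolver using (solve⊆; solve≡; _⊑_; _⊔_; _⊓_; _∖_; ø; x₀; x₁; x₂; x₃; x₄)

-- Cardinalities of finite subsets.

∣∪∣+∣∩∣ : ∀ {m} (S T : Subset m) → ∣ S ∪ T ∣ ℕ.+ ∣ S ∩ T ∣ ≡ ∣ S ∣ ℕ.+ ∣ T ∣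
∣∪∣+∣∩∣ []          []          = refl
∣∪∣+∣∩∣ (true  ∷ S) (true  ∷ T) =
  cong suc (trans (ℕ.+-suc _ _) (trans (cong suc (∣∪∣+∣∩∣ S T)) (sym (ℕ.+-suc _ _))))
∣∪∣+∣∩∣ (true  ∷ S) (false ∷ T) = cong suc (∣∪∣+∣∩∣ S T)
∣∪∣+∣∩∣ (false ∷ S) (true  ∷ T) = trans (cong suc (∣∪∣+∣∩∣ S T)) (sym (ℕ.+-suc _ _))
∣∪∣+∣∩∣ (false ∷ S) (false ∷ T) = ∣∪∣+∣∩∣ S T

module _ {n : ℕ} where

  ∈⇒⁅⁆⊆ : ∀ {x} {S : Subset n} → x ∈ S → ⁅ x ⁆ ⊆ S
  ∈⇒⁅⁆⊆ x∈S y∈⁅x⁆ with refl ← x∈⁅y⁆⇒x≡y _ y∈⁅x⁆ = x∈S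

  ∉⇒⁅⁆∩⊆⊥ : ∀ {x} {S : Subset n} → x ∉ S → ⁅ x ⁆ ∩ S ⊆ ⊥
  ∉⇒⁅⁆∩⊆⊥ {x} {S} x∉S y∈ with y∈⁅x⁆ , y∈S ← x∈p∩q⁻ ⁅ x ⁆ S y∈
                          with refl ← x∈⁅y⁆⇒x≡y _ y∈⁅x⁆ = contradiction y∈S x∉S

  ∣∪⁅⁆∣ : ∀ {x} {S : Subset n} → x ∉ S → ∣ S ∪ ⁅ x ⁆ ∣ ≡ suc ∣ S ∣
  ∣∪⁅⁆∣ {x} {S} x∉S = begin
    ∣ S ∪ ⁅ x ⁆ ∣                      ≡⟨ ℕ.+-identityʳ _ ⟨
    ∣ S ∪ ⁅ x ⁆ ∣ ℕ.+ 0                ≡⟨ cong (∣ S ∪ ⁅ x ⁆ ∣ ℕ.+_) (∣⊥∣≡0 n) ⟨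
    ∣ S ∪ ⁅ x ⁆ ∣ ℕ.+ ∣ ⊥ {n} ∣        ≡⟨ cong (λ U → ∣ S ∪ ⁅ x ⁆ ∣ ℕ.+ ∣ U ∣)
                                            (solve≡ ((x₁ ⊓ x₀ ⊑ ø) ∷ []) ø (x₀ ⊓ x₁) (S ∷ ⁅ x ⁆ ∷ []) (∉⇒⁅⁆∩⊆⊥ x∉S ∷ [])) ⟩
    ∣ S ∪ ⁅ x ⁆ ∣ ℕ.+ ∣ S ∩ ⁅ x ⁆ ∣    ≡⟨ ∣∪∣+∣∩∣ S ⁅ x ⁆ ⟩
    ∣ S ∣ ℕ.+ ∣ ⁅ x ⁆ ∣                ≡⟨ cong (∣ S ∣ ℕ.+_) (∣⁅x⁆∣≡1 x) ⟩
    ∣ S ∣ ℕ.+ 1                        ≡⟨ ℕ.+-comm _ 1 ⟩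
    suc ∣ S ∣                          ∎
    where open ≡.≡-Reasoning

  ∣-∣ : ∀ {x} {S : Subset n} → x ∈ S → suc ∣ S ─ ⁅ x ⁆ ∣ ≡ ∣ S ∣
  ∣-∣ {x} {S} x∈S = trans
    (sym (∣∪⁅⁆∣ {S = S ─ ⁅ x ⁆} (λ x∈ → contradiction (x∈⁅x⁆ x)
      (λ x∈⁅x⁆ → ∉⊥ (solve⊆ [] (x₀ ∖ x₁ ⊓ x₁) ø (S ∷ ⁅ x ⁆ ∷ []) [] (x∈p∩q⁺ (x∈ , x∈⁅x⁆)))))))
    (cong ∣_∣ (solve≡ ((x₁ ⊑ x₀) ∷ []) (x₀ ∖ x₁ ⊔ x₁) x₀ (S ∷ ⁅ x ⁆ ∷ []) (∈⇒⁅⁆⊆ x∈S ∷ [])))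

  ⊆-or-outside : (S T : Subset n) → S ⊆ T ⊎ ∃[ x ] x ∈ S × x ∉ T
  ⊆-or-outside S T with nonempty? (S ─ T)
  ... | yes (x , x∈) = inj₂ (x , p─q⊆p S T x∈ , λ x∈T →
          ∉⊥ (solve⊆ [] (x₀ ∖ x₁ ⊓ x₁) ø (S ∷ T ∷ []) [] (x∈p∩q⁺ (x∈ , x∈T))))
  ... | no  empty = inj₁ λ {x} x∈S → helper x∈S (x ∈? T)
    where
    helper : ∀ {x} → x ∈ S → Dec (x ∈ T) → x ∈ T
    helper x∈S (yes x∈T) = x∈T
    helper x∈S (no x∉T)  = contradiction (_ , x∈p∧x∉q⇒x∈p─q x∈S x∉T) empty

  ⊆∧∣∣≥⇒≡ : ∀ {S T : Subset n} → S ⊆ T → ∣ T ∣ ℕ.≤ ∣ S ∣ → T ≡ S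
  ⊆∧∣∣≥⇒≡ {S} {T} S⊆T ∣T∣≤∣S∣ with ⊆-or-outside T S
  ... | inj₁ T⊆S             = ⊆-antisym T⊆S S⊆T
  ... | inj₂ (x , x∈T , x∉S) =
    contradiction ∣T∣≤∣S∣ (ℕ.<⇒≱ (p⊂q⇒∣p∣<∣q∣ ((λ {y} → S⊆T {y}) , x , x∈T , x∉S)))

module _ {n : ℕ} where

  comprehension : {P : Pred (Fin n) 0ℓ} → Decidable P →
                  ∃[ S ] (∀ {x} → x ∈ S → P x) × (∀ {x} → P x → x ∈ S)
  comprehension {P} P? = S , to , from
    where
    S : Subset n
    S = tabulate (λ x → does (P? x))
    to : ∀ {x} → x ∈ S → P x
    to {x} x∈S with P? x | trans (sym (lookup∘tabulate (λ x → does (P? x)) x)) ([]=⇒lookup x∈S)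
    ... | yes p | _ = p
    from : ∀ {x} → P x → x ∈ S
    from {x} p = lookup⇒[]= x S (trans (lookup∘tabulate (λ x → does (P? x)) x) eq)
      where
      eq : does (P? x) ≡ true
      eq with P? x
      ... | yes _ = refl
      ... | no ¬p = contradiction p ¬p

-- Matroids: augmentation, symmetric exchange, covering a base by two bases.

module MatroidProperties {n : ℕ} (M : Matroid n) where
  open Matroid M

  base-largest : ∀ {X I} → IsBase X → Indep I → ∣ I ∣ ℕ.≤ ∣ X ∣
  base-largest {X} {I} (indX , maxX) indI = ℕ.≮⇒≥ λ ∣X∣<∣I∣ →
    let x , _ , x∉X , ind = exchange indX indI ∣X∣<∣I∣
    in x∉X (subst (x ∈_) (maxX (X ∪ ⁅ x ⁆) ind (p⊆p∪q ⁅ x ⁆)) (q⊆p∪q X ⁅ x ⁆ (x∈⁅x⁆ x)))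

  largest⇒base : ∀ {X I} → IsBase X → Indep I → ∣ X ∣ ℕ.≤ ∣ I ∣ → IsBase I
  largest⇒base baseX indI ∣X∣≤∣I∣ =
    indI , λ T indT I⊆T → ⊆∧∣∣≥⇒≡ I⊆T (ℕ.≤-trans (base-largest baseX indT) ∣X∣≤∣I∣)

  augment : ∀ k {I J} → Indep I → Indep J → k ℕ.+ ∣ I ∣ ≡ ∣ J ∣ →
            ∃[ Z ] Indep Z × I ⊆ Z × Z ⊆ I ∪ J × ∣ Z ∣ ≡ ∣ J ∣
  augment zero    {I} {J} indI indJ eq = I , indI , ⊆-refl , p⊆p∪q J , eq
  augment (suc k) {I} {J} indI indJ eq
    with x , x∈J , x∉I , ind ← exchange indI indJ (subst (∣ I ∣ ℕ.<_) eq (ℕ.s≤s (ℕ.m≤n+m ∣ I ∣ k)))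
    with Z , indZ , I+x⊆Z , Z⊆ , ∣Z∣ ← augment k ind indJ
           (trans (cong (k ℕ.+_) (∣∪⁅⁆∣ x∉I)) (trans (ℕ.+-suc k _) eq))
    = Z , indZ
    , solve⊆ ((x₀ ⊔ x₁ ⊑ x₂) ∷ []) x₀ x₂ (I ∷ ⁅ x ⁆ ∷ Z ∷ []) (I+x⊆Z ∷ [])
    , solve⊆ ((x₃ ⊑ x₀ ⊔ x₁ ⊔ x₂) ∷ (x₁ ⊑ x₂) ∷ []) x₃ (x₀ ⊔ x₂) (I ∷ ⁅ x ⁆ ∷ J ∷ Z ∷ [])
        (Z⊆ ∷ ∈⇒⁅⁆⊆ x∈J ∷ [])
    , ∣Z∣

  augment≤ : ∀ {I J} → Indep I → Indep J → ∣ I ∣ ℕ.≤ ∣ J ∣ →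
             ∃[ Z ] Indep Z × I ⊆ Z × Z ⊆ I ∪ J × ∣ Z ∣ ≡ ∣ J ∣
  augment≤ indI indJ ∣I∣≤∣J∣ = augment _ indI indJ (ℕ.m∸n+n≡m ∣I∣≤∣J∣)

  module SymmetricExchange {X C} (baseX : IsBase X) (baseC : IsBase C)
                           {x} (x∈X : x ∈ X) (x∉C : x ∉ C) where

    private
      comp = comprehension {P = λ c → c ∈ C × Indep ((C ─ ⁅ c ⁆) ∪ ⁅ x ⁆)}
               (λ c → (c ∈? C) ×-dec indep? ((C ─ ⁅ c ⁆) ∪ ⁅ x ⁆))

    -- With x added, this is the unique circuit in C ∪ {x}.
    circuit : Subset n
    circuit = proj₁ comp

    circuit⁻ : ∀ {c} → c ∈ circuit → c ∈ C × Indep ((C ─ ⁅ c ⁆) ∪ ⁅ x ⁆)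
    circuit⁻ = proj₁ (proj₂ comp)

    circuit⁺ : ∀ {c} → c ∈ C × Indep ((C ─ ⁅ c ⁆) ∪ ⁅ x ⁆) → c ∈ circuit
    circuit⁺ = proj₂ (proj₂ comp)

    -- Otherwise the set extends inside C ∪ {x} to an independent `Z` of the size of `C`. As `Z`
    -- contains `x`, it misses some `c` of `C`, and then `Z` is C with `c` replaced by `x`. So `c`
    -- lies in `circuit` by definition, although `circuit ⊆ Z`.
    circuit-dependent : ¬ Indep (circuit ∪ ⁅ x ⁆)
    circuit-dependent ind
      with Z , indZ , circuit+x⊆Z , Z⊆ , ∣Z∣ ← augment≤ ind (proj₁ baseC) (base-largest baseC ind)
      with ⊆-or-outside C Z
    ... | inj₁ C⊆Z = x∉C (subst (x ∈_) (⊆∧∣∣≥⇒≡ C⊆Z (ℕ.≤-reflexive ∣Z∣))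
                       (circuit+x⊆Z (q⊆p∪q circuit ⁅ x ⁆ (x∈⁅x⁆ x))))
    ... | inj₂ (c , c∈C , c∉Z) = c∉Z (circuit+x⊆Z (p⊆p∪q ⁅ x ⁆ (circuit⁺ (c∈C , subst Indep (sym eq) indZ))))
      where
      x∉C-c : x ∉ C ─ ⁅ c ⁆
      x∉C-c x∈ = x∉C (p─q⊆p C ⁅ c ⁆ x∈)
      eq : (C ─ ⁅ c ⁆) ∪ ⁅ x ⁆ ≡ Z
      eq = ⊆∧∣∣≥⇒≡
        (solve⊆ ((x₀ ⊑ (x₃ ⊔ x₁) ⊔ x₂) ∷ (x₃ ⊑ x₂) ∷ (x₄ ⊓ x₀ ⊑ ø) ∷ [])
           x₀ ((x₂ ∖ x₄) ⊔ x₁) (Z ∷ ⁅ x ⁆ ∷ C ∷ circuit ∷ ⁅ c ⁆ ∷ [])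
           (Z⊆ ∷ (λ q∈ → proj₁ (circuit⁻ q∈)) ∷ ∉⇒⁅⁆∩⊆⊥ c∉Z ∷ []))
        (ℕ.≤-reflexive (trans (∣∪⁅⁆∣ x∉C-c) (trans (∣-∣ c∈C) (sym ∣Z∣))))

    -- If no element of the circuit could replace x in X, then X - x would be
    -- maximal independent in X - x together with the circuit.
    exchange-pair : ∃[ c ] c ∈ C × c ∉ X × Indep ((C ─ ⁅ c ⁆) ∪ ⁅ x ⁆) × Indep ((X ─ ⁅ x ⁆) ∪ ⁅ c ⁆)
    exchange-pair = answer
      where
      indC = proj₁ baseC
      indX = proj₁ baseX
      indQ : Indep circuit
      indQ = hereditary (λ q∈ → proj₁ (circuit⁻ q∈)) indC
      indX-x : Indep (X ─ ⁅ x ⁆)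
      indX-x = hereditary (p─q⊆p X ⁅ x ⁆) indX

      finish : ∀ {U} → Indep U → U ⊆ (X ─ ⁅ x ⁆) ∪ circuit → ∣ X ─ ⁅ x ⁆ ∣ ℕ.< ∣ U ∣ →
               ∃[ c ] c ∈ C × c ∉ X × Indep ((C ─ ⁅ c ⁆) ∪ ⁅ x ⁆) × Indep ((X ─ ⁅ x ⁆) ∪ ⁅ c ⁆)
      finish indU U⊆ lt
        with c , c∈U , c∉X-x , ind ← exchange indX-x indU lt
        with x∈p∪q⁻ (X ─ ⁅ x ⁆) circuit (U⊆ c∈U)
      ... | inj₁ c∈X-x = contradiction c∈X-x c∉X-x
      ... | inj₂ c∈Q with c∈C , ind′ ← circuit⁻ c∈Q =
        c , c∈C , (λ c∈X → c∉X-x (x∈p∧x≢y⇒x∈p-y c∈X λ { refl → x∉C c∈C })) , ind′ , ind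

      answer : ∃[ c ] c ∈ C × c ∉ X × Indep ((C ─ ⁅ c ⁆) ∪ ⁅ x ⁆) × Indep ((X ─ ⁅ x ⁆) ∪ ⁅ c ⁆)
      answer with ∣ circuit ∣ ℕ.≤? ∣ X ─ ⁅ x ⁆ ∣
      ... | no  gt = finish indQ (q⊆p∪q (X ─ ⁅ x ⁆) circuit) (ℕ.≰⇒> gt)
      -- The circuit is first filled up from `X ─ ⁅ x ⁆` to a set `Z` of size ∣X∣ - 1, to which `X`
      -- then supplies one more element `z`. It is not `x`, because the circuit together with `x` is
      -- dependent; so `Z ∪ ⁅ z ⁆` stays inside `(X ─ ⁅ x ⁆) ∪ circuit` and is larger than
      -- `X ─ ⁅ x ⁆`.
      ... | yes le
        with Z , indZ , Q⊆Z , Z⊆ , ∣Z∣ ← augment≤ indQ indX-x le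
        with z , z∈X , z∉Z , ind ← exchange indZ indX (ℕ.≤-reflexive (trans (cong suc ∣Z∣) (∣-∣ x∈X)))
        = finish ind
            (solve⊆ ((x₀ ⊑ x₁ ⊔ x₂) ∷ (x₃ ⊑ x₂) ∷ []) (x₀ ⊔ x₃) (x₂ ⊔ x₁)
               (Z ∷ circuit ∷ (X ─ ⁅ x ⁆) ∷ ⁅ z ⁆ ∷ []) (Z⊆ ∷ ∈⇒⁅⁆⊆ z∈X-x ∷ []))
            (ℕ.≤-reflexive (sym (trans (∣∪⁅⁆∣ z∉Z) (cong suc ∣Z∣))))
        where
        z∈X-x : z ∈ X ─ ⁅ x ⁆
        z∈X-x = x∈p∧x≢y⇒x∈p-y z∈X λ { refl → circuit-dependent (hereditary
          (solve⊆ ((x₀ ⊑ x₁) ∷ []) (x₀ ⊔ x₂) (x₁ ⊔ x₂) (circuit ∷ Z ∷ ⁅ x ⁆ ∷ []) (Q⊆Z ∷ [])) ind) }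

  exchanged-base : ∀ {X x c} → IsBase X → x ∈ X → c ∉ X → Indep ((X ─ ⁅ x ⁆) ∪ ⁅ c ⁆) → IsBase ((X ─ ⁅ x ⁆) ∪ ⁅ c ⁆)
  exchanged-base {X} {x} {c} baseX x∈X c∉X ind = largest⇒base baseX ind
    (ℕ.≤-reflexive (sym (trans (∣∪⁅⁆∣ {S = X ─ ⁅ x ⁆} (λ c∈ → c∉X (p─q⊆p X ⁅ x ⁆ c∈))) (∣-∣ x∈X))))

  -- This is the proof that the union of a matroid with itself is a matroid:
  -- P and Q grow one element of A or B at a time, which may have to be moved
  -- from one of them to the other, and ∣ P ∩ A ∣ + ∣ Q ∩ B ∣ increases.
  module Spreading {K : Subset n} where

    record Spread (X P Q : Subset n) : Set where
      field
        indP : Indep P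
        indQ : Indep Q
        K⊆P  : K ⊆ P
        K⊆Q  : K ⊆ Q
        P∩Q⊆ : P ∩ Q ⊆ K
        X⊆   : X ⊆ P ∪ Q
    open Spread

    flip : ∀ {X P Q} → Spread X P Q → Spread X Q P
    flip {X} {P} {Q} s = record
      { indP = indQ s ; indQ = indP s ; K⊆P = K⊆Q s ; K⊆Q = K⊆P s
      ; P∩Q⊆ = subst (_⊆ K) (∩-comm P Q) (P∩Q⊆ s) ; X⊆ = subst (X ⊆_) (∪-comm P Q) (X⊆ s) }

    module _ {X A B : Subset n} (indA : Indep A) (A∩B⊆⊥ : A ∩ B ⊆ ⊥) where
      -- The new element `a` of `P` is taken from `A` and removed from `Q` in case it was there.
      -- Disjointness of `A` and `B` enters here: the removal leaves `Q ∩ B` unchanged, so the sum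
      -- rises by exactly one. Since `a` is outside `P ⊇ K`, the set `Q` keeps all of `K`.
      grow : ∀ {P Q} → Spread X P Q → ∣ P ∣ ℕ.< ∣ A ∣ →
             ∃[ P′ ] ∃[ Q′ ] Spread X P′ Q′ × ∣ P′ ∩ A ∣ ℕ.+ ∣ Q′ ∩ B ∣ ≡ suc (∣ P ∩ A ∣ ℕ.+ ∣ Q ∩ B ∣)
      grow {P} {Q} s lt with a , a∈A , a∉P , ind ← exchange (indP s) indA lt =
        P ∪ ⁅ a ⁆ , Q ─ ⁅ a ⁆ , s′ , cong₂ ℕ._+_ ∣P′∩A∣ (cong ∣_∣ Q′∩B)
        where
        a⊆A = ∈⇒⁅⁆⊆ a∈A
        a∩P⊆⊥ = ∉⇒⁅⁆∩⊆⊥ a∉P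
        s′ : Spread X (P ∪ ⁅ a ⁆) (Q ─ ⁅ a ⁆)
        s′ = record
          { indP = ind
          ; indQ = hereditary (p─q⊆p Q ⁅ a ⁆) (indQ s)
          ; K⊆P  = ⊆-trans (K⊆P s) (p⊆p∪q ⁅ a ⁆)
          ; K⊆Q  = solve⊆ ((x₀ ⊑ x₁) ∷ (x₀ ⊑ x₂) ∷ (x₃ ⊓ x₁ ⊑ ø) ∷ []) x₀ (x₂ ∖ x₃)
                     (K ∷ P ∷ Q ∷ ⁅ a ⁆ ∷ []) (K⊆P s ∷ K⊆Q s ∷ a∩P⊆⊥ ∷ [])
          ; P∩Q⊆ = solve⊆ ((x₁ ⊓ x₂ ⊑ x₀) ∷ []) ((x₁ ⊔ x₃) ⊓ (x₂ ∖ x₃)) x₀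
                     (K ∷ P ∷ Q ∷ ⁅ a ⁆ ∷ []) (P∩Q⊆ s ∷ [])
          ; X⊆   = solve⊆ ((x₀ ⊑ x₁ ⊔ x₂) ∷ []) x₀ ((x₁ ⊔ x₃) ⊔ (x₂ ∖ x₃))
                     (X ∷ P ∷ Q ∷ ⁅ a ⁆ ∷ []) (X⊆ s ∷ []) }
        ∣P′∩A∣ : ∣ (P ∪ ⁅ a ⁆) ∩ A ∣ ≡ suc ∣ P ∩ A ∣
        ∣P′∩A∣ = trans
          (cong ∣_∣ (solve≡ ((x₁ ⊑ x₂) ∷ []) ((x₀ ⊔ x₁) ⊓ x₂) ((x₀ ⊓ x₂) ⊔ x₁) (P ∷ ⁅ a ⁆ ∷ A ∷ []) (a⊆A ∷ [])))
          (∣∪⁅⁆∣ {S = P ∩ A} (λ a∈ → a∉P (p∩q⊆p P A a∈)))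
        Q′∩B : (Q ─ ⁅ a ⁆) ∩ B ≡ Q ∩ B
        Q′∩B = solve≡ ((x₁ ⊑ x₂) ∷ (x₂ ⊓ x₃ ⊑ ø) ∷ []) ((x₀ ∖ x₁) ⊓ x₃) (x₀ ⊓ x₃)
                 (Q ∷ ⁅ a ⁆ ∷ A ∷ B ∷ []) (a⊆A ∷ A∩B⊆⊥ ∷ [])

    module _ {X A B : Subset n} (baseA : IsBase A) (baseB : IsBase B) (A∩B⊆⊥ : A ∩ B ⊆ ⊥) where
      -- The fuel `k` is the distance of the potential from its bound `∣ A ∣ + ∣ B ∣`. At zero both
      -- intersections are full, so neither `P` nor `Q` can be too small to be a base. When `Q` is
      -- the small one, `grow` is applied with the two sides exchanged.
      spread-fuelled : ∀ k {P Q} → Spread X P Q → ∣ A ∣ ℕ.+ ∣ B ∣ ≡ k ℕ.+ (∣ P ∩ A ∣ ℕ.+ ∣ Q ∩ B ∣) →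
                       ∃[ P′ ] ∃[ Q′ ] Spread X P′ Q′ × IsBase P′ × IsBase Q′
      spread-fuelled k {P} {Q} s eq with ∣ A ∣ ℕ.≤? ∣ P ∣ | ∣ B ∣ ℕ.≤? ∣ Q ∣
      ... | yes A≤P | yes B≤Q =
        P , Q , s , largest⇒base baseA (indP s) A≤P , largest⇒base baseB (indQ s) B≤Q
      spread-fuelled zero {P} {Q} s eq | no A≰P | _ = contradiction eq (ℕ.>⇒≢
        (ℕ.+-mono-<-≤ (ℕ.≤-<-trans (∣p∩q∣≤∣p∣ P A) (ℕ.≰⇒> A≰P)) (∣p∩q∣≤∣q∣ Q B)))
      spread-fuelled zero {P} {Q} s eq | yes _ | no B≰Q = contradiction eq (ℕ.>⇒≢
        (ℕ.+-mono-≤-< (∣p∩q∣≤∣q∣ P A) (ℕ.≤-<-trans (∣p∩q∣≤∣p∣ Q B) (ℕ.≰⇒> B≰Q))))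
      spread-fuelled (suc k) s eq | no A≰P | _
        with _ , _ , s′ , eq′ ← grow (proj₁ baseA) A∩B⊆⊥ s (ℕ.≰⇒> A≰P) =
        spread-fuelled k s′ (trans eq (trans (sym (ℕ.+-suc k _)) (cong (k ℕ.+_) (sym eq′))))
      spread-fuelled (suc k) {P} {Q} s eq | yes _ | no B≰Q
        with Q′ , P′ , s′ , eq′ ← grow (proj₁ baseB) (subst (_⊆ ⊥) (∩-comm A B) A∩B⊆⊥) (flip s) (ℕ.≰⇒> B≰Q) =
        spread-fuelled k (flip s′) (trans eq (trans (sym (ℕ.+-suc k _)) (cong (k ℕ.+_)
          (trans (cong suc (ℕ.+-comm ∣ P ∩ A ∣ ∣ Q ∩ B ∣)) (trans (sym eq′) (ℕ.+-comm ∣ Q′ ∩ B ∣ ∣ P′ ∩ A ∣))))))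

    spread : HasTwoDisjointBases → ∀ {X} → IsBase X → K ⊆ X →
             ∃[ P ] ∃[ Q ] Spread X P Q × IsBase P × IsBase Q
    spread (A , B , baseA , baseB , A∩B∅) {X} baseX K⊆X =
      spread-fuelled baseA baseB (λ x∈ → contradiction (_ , x∈) A∩B∅)
        (∣ A ∣ ℕ.+ ∣ B ∣ ℕ.∸ (∣ X ∩ A ∣ ℕ.+ ∣ K ∩ B ∣))
        -- The start is P = X and Q = K, which cover `X` and meet exactly in `K`.
        (record
          { indP = proj₁ baseX
          ; indQ = hereditary K⊆X (proj₁ baseX)
          ; K⊆P  = K⊆X
          ; K⊆Q  = ⊆-refl
          ; P∩Q⊆ = p∩q⊆q X K
          ; X⊆   = p⊆p∪q K })
        (sym (ℕ.m∸n+n≡m (ℕ.+-mono-≤ (∣p∩q∣≤∣q∣ X A) (∣p∩q∣≤∣q∣ K B))))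

-- Arithmetic in an ordered field, and the final calculation of the ratio.

module OrderedField (R : Reals) where
  open Reals R public
  open CommutativeRing commutativeRing public
    using (+-cong; +-congˡ; +-congʳ; *-congˡ; *-congʳ; +-identityˡ; +-identityʳ; *-identityˡ; *-identityʳ;
           -‿inverseʳ; -‿inverseˡ; zeroʳ; *-comm; +-comm; +-assoc; *-assoc; distribˡ; distribʳ; semiring; commutativeSemiring)
    renaming (refl to ≈-refl; sym to ≈-sym; trans to ≈-trans; reflexive to ≈-reflexive)
  open RawMonoidDefinitions +-rawMonoid public using () renaming (_×_ to _·_)
  open SemiringMult semiring using (×-assoc-*; ×1-homo-*; ×-congʳ)
  open IsDecTotalOrder isDecTotalOrder public using ()
    renaming (refl to ≤-refl; trans to ≤-trans; antisym to ≤-antisym; total to ≤-total; reflexive to ≤-reflexive)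
  open RingSolver commutativeSemiring public using (solve; _:+_; _:*_; _:=_; con; Polynomial)

  poset : Poset 0ℓ 0ℓ 0ℓ
  poset = record { isPartialOrder = IsDecTotalOrder.isPartialOrder isDecTotalOrder }

  module ≤-Reasoning = PosetReasoning poset

  +-mono-≤ : ∀ {a b c d} → a ≤ b → c ≤ d → a + c ≤ b + d
  +-mono-≤ {a} {b} {c} {d} a≤b c≤d = begin
    a + c ≤⟨ +-monoˡ-≤ c a≤b ⟩
    b + c ≈⟨ +-comm b c ⟩
    c + b ≤⟨ +-monoˡ-≤ b c≤d ⟩
    d + b ≈⟨ +-comm d b ⟩
    b + d ∎
    where open ≤-Reasoning

  +-cancelʳ-≤ : ∀ z {x y} → x + z ≤ y + z → x ≤ y
  +-cancelʳ-≤ z {x} {y} le = begin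
    x               ≈⟨ shift x ⟨
    (x + z) + (- z) ≤⟨ +-monoˡ-≤ (- z) le ⟩
    (y + z) + (- z) ≈⟨ shift y ⟩
    y               ∎
    where
    open ≤-Reasoning
    shift : ∀ u → (u + z) + (- z) ≈ u
    shift u = ≈-trans (+-assoc u z (- z)) (≈-trans (+-congˡ (-‿inverseʳ z)) (+-identityʳ u))

  -- To derive l ≤ r, take for a ≤ b a combination of the hypotheses; what
  -- remains is a semiring identity.
  linear : ∀ {a b l r} → a ≤ b → l + b ≈ r + a → l ≤ r
  linear {a} {b} {l} {r} a≤b eq = +-cancelʳ-≤ b (begin
    l + b ≈⟨ eq ⟩
    r + a ≈⟨ +-comm r a ⟩
    a + r ≤⟨ +-monoˡ-≤ r a≤b ⟩
    b + r ≈⟨ +-comm b r ⟩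
    r + b ∎)
    where open ≤-Reasoning

  <⇒≤ : ∀ {a b} → a < b → a ≤ b
  <⇒≤ {a} {b} a<b with ≤-total a b
  ... | inj₁ a≤b = a≤b
  ... | inj₂ b≤a = contradiction b≤a a<b

  [x-y]+y≈x : ∀ x y → (x - y) + y ≈ x
  [x-y]+y≈x x y = ≈-trans (+-assoc x (- y) y) (≈-trans (+-congˡ (-‿inverseˡ y)) (+-identityʳ x))

  -- The solver works in a commutative semiring, without subtraction; naming the slack turns an
  -- inequality into an equation that it can use.
  difference : ∀ {a b} → a ≤ b → ∃[ d ] 0# ≤ d × b ≈ a + d
  difference {a} {b} a≤b =
    b - a , linear a≤b (≈-trans (+-identityˡ b) (≈-sym ([x-y]+y≈x b a)))
          , ≈-trans (≈-sym ([x-y]+y≈x b a)) (+-comm (b - a) a)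

  *-monoˡ-≤ : ∀ {c a b} → 0# ≤ c → a ≤ b → c * a ≤ c * b
  *-monoˡ-≤ {c} {a} {b} 0≤c a≤b with d , 0≤d , b≈a+d ← difference a≤b =
    linear (*-nonNegative 0≤c 0≤d)
      (≈-trans (solve 3 (λ c a d → c :* a :+ c :* d := c :* (a :+ d) :+ con 0) ≈-refl c a d)
               (+-cong (*-congˡ (≈-sym b≈a+d)) (≈-refl)))

  *-cancelˡ-≤ : ∀ {c a b} → 0# < c → c * a ≤ c * b → a ≤ b
  *-cancelˡ-≤ {c} {a} {b} 0<c ca≤cb with ≤-total a b
  ... | inj₁ a≤b = a≤b
  ... | inj₂ b≤a = ≤-reflexive (begin-equality
    a                ≈⟨ unit a ⟩
    c ⁻¹ * (c * a)   ≈⟨ *-congˡ (≤-antisym ca≤cb (*-monoˡ-≤ (<⇒≤ 0<c) b≤a)) ⟩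
    c ⁻¹ * (c * b)   ≈⟨ unit b ⟨
    b                ∎)
    where
    open ≤-Reasoning
    unit : ∀ u → u ≈ c ⁻¹ * (c * u)
    unit u = ≈-trans (≈-sym (*-identityˡ u))
      (≈-trans (*-congʳ (≈-sym (⁻¹-inverse c (λ c≈0 → 0<c (≤-reflexive c≈0)))))
        (solve 3 (λ c i u → (c :* i) :* u := i :* (c :* u)) ≈-refl c (c ⁻¹) u))

  *-positive : ∀ {a b} → 0# < a → 0# < b → 0# < a * b
  *-positive {a} 0<a 0<b ab≤0 = 0<b (*-cancelˡ-≤ 0<a (≤-trans ab≤0 (≤-reflexive (≈-sym (zeroʳ a)))))

  0≤1 : 0# ≤ 1#
  0≤1 with ≤-total 0# 1#
  ... | inj₁ le = le
  -- Here `d` is -1: its square is non-negative as a product of non-negatives, and equals 1.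
  ... | inj₂ 1≤0 with d , 0≤d , 0≈1+d ← difference 1≤0 =
    linear (*-nonNegative 0≤d 0≤d) (begin-equality
      0# + d * d          ≈⟨ +-congʳ 0≈1+d ⟩
      (1# + d) + d * d    ≈⟨ solve 1 (λ d → (con 1 :+ d) :+ d :* d := con 1 :+ d :* (con 1 :+ d)) ≈-refl d ⟩
      1# + d * (1# + d)   ≈⟨ +-congˡ (*-congˡ 0≈1+d) ⟨
      1# + d * 0#         ≈⟨ +-congˡ (zeroʳ d) ⟩
      1# + 0#             ∎)
    where open ≤-Reasoning

  0≤fromℕ : ∀ k → 0# ≤ fromℕ k
  0≤fromℕ zero    = ≤-refl
  0≤fromℕ (suc k) = ≤-trans (≤-reflexive (≈-sym (+-identityʳ 0#))) (+-mono-≤ 0≤1 (0≤fromℕ k))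

  1≤fromℕ : ∀ k → 1# ≤ fromℕ (suc k)
  1≤fromℕ k = ≤-trans (≤-reflexive (≈-sym (+-identityʳ 1#))) (+-mono-≤ ≤-refl (0≤fromℕ k))

  0<1≤ : ∀ {x} → 1# ≤ x → 0# < x
  0<1≤ 1≤x x≤0 = 1≉0 (≤-antisym (≤-trans 1≤x x≤0) 0≤1)

  ·-nonNegative : ∀ k {x} → 0# ≤ x → 0# ≤ k · x
  ·-nonNegative zero    0≤x = ≤-refl
  ·-nonNegative (suc k) 0≤x = ≤-trans (≤-reflexive (≈-sym (+-identityʳ 0#))) (+-mono-≤ 0≤x (·-nonNegative k 0≤x))

  ·≈* : ∀ k x → k · x ≈ fromℕ k * x
  ·≈* k x = ≈-trans (×-congʳ k (≈-sym (*-identityˡ x))) (≈-sym (×-assoc-* k 1# x))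

  fromℕ-* : ∀ j k → fromℕ (j ℕ.* k) ≈ fromℕ j * fromℕ k
  fromℕ-* = ×1-homo-*

  ·-monoˡ-≤ : ∀ {j k x} → 0# ≤ x → j ℕ.≤ k → j · x ≤ k · x
  ·-monoˡ-≤ {k = k} 0≤x ℕ.z≤n       = ·-nonNegative k 0≤x
  ·-monoˡ-≤         0≤x (ℕ.s≤s j≤k) = +-mono-≤ ≤-refl (·-monoˡ-≤ 0≤x j≤k)

  -- The multiples of ε below b have a supremum s; one of them exceeds s - ε,
  -- so the next one exceeds b.
  archimedean : ∀ {ε b} → 0# < ε → 0# ≤ b → ∃[ k ] b ≤ k · ε
  archimedean {ε} {b} 0<ε 0≤b
    with s , bounds , approached ← complete (λ x → x ≤ b × ∃[ k ] x ≈ k · ε) (0# , 0≤b , 0 , ≈-refl)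
                                            (b , λ _ → proj₁)
    with x , (_ , k , x≈kε) , s-ε<x ← approached (s - ε) (λ s≤s-ε → 0<ε (linear s≤s-ε
           (≈-trans (+-comm ε (s - ε)) (≈-trans ([x-y]+y≈x s ε) (≈-sym (+-identityˡ s))))))
    with ≤-total b (suc k · ε)
  ... | inj₁ b≤ = suc k , b≤
  ... | inj₂ ≤b = contradiction (linear (bounds (suc k · ε) (≤b , suc k , ≈-refl))
    (≈-trans (+-comm x s) (≈-trans (+-congʳ (≈-sym ([x-y]+y≈x s ε)))
      (≈-trans (+-assoc (s - ε) ε x) (+-congˡ (+-congˡ x≈kε)))))) s-ε<x

  numeral : ∀ {k} → ℕ → Polynomial k
  numeral zero    = con 0
  numeral (suc j) = con 1 :+ numeral j

  -- The purely numerical end of the analysis. `s`, `t`, `x` stand for the values of `S`, `T ─ S`,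
  -- `X`; the pairs `u`, `v` for the union and intersection of `S` and of `T` with the optimal base,
  -- the latter pair without `S`; the pairs `p`, `q` for those of `X` with the two covering bases.
  -- In the main case `c` is n, `κ` is k and `ν` is k n².
  ratio-bound : ∀ {ε m b s t x w ν c κ u₁ u₂ v₁ v₂ p₁ p₂ q₁ q₂} →
    0# < ν → 0# ≤ m → 0# ≤ v₂ → 1# ≤ c → ν ≈ κ * (c * c) → fromℕ 4 ≤ κ * ε →
    m ≤ (u₁ + u₂) + v₁ →
    t + (x + x) ≤ (p₁ + p₂) + (q₁ + q₂) →
    ν * (u₁ + u₂) ≤ ν * (s + s) + c * w →
    ν * (v₁ + v₂) ≤ ν * (t + t) + c * w →
    ν * (p₁ + p₂) ≤ ν * (x + x) + c * w →
    ν * (q₁ + q₂) ≤ ν * (x + x) + c * w →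
    w ≤ (1# + c) * (m + m) →
    s ≤ b → x ≤ b →
    (fromℕ 6 ⁻¹ - ε) * m ≤ b
  ratio-bound {ε} {m} {b} {s} {t} {x} {w} {ν} {c} {κ} {u₁} {u₂} {v₁} {v₂} {p₁} {p₂} {q₁} {q₂}
    0<ν 0≤m 0≤v₂ 1≤c ν≈ 4≤κε m≤ t≤ u≤ v≤ p≤ q≤ w≤ s≤b x≤b =
    *-cancelˡ-≤ (0<1≤ (1≤fromℕ 5)) (linear m≤6b+6εm (begin-equality
      6# * (δ * m) + (6# * b + 6# * (ε * m))
        ≈⟨ solve 5 (λ s δ m b e → s :* (δ :* m) :+ (s :* b :+ s :* (e :* m)) := s :* b :+ (s :* (δ :+ e)) :* m) ≈-refl 6# δ m b ε ⟩
      6# * b + (6# * (δ + ε)) * m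
        ≈⟨ +-congˡ (*-congʳ (≈-trans (*-congˡ ([x-y]+y≈x (6# ⁻¹) ε)) (⁻¹-inverse 6# λ 6≈0 → 0<1≤ (1≤fromℕ 5) (≤-reflexive 6≈0)))) ⟩
      6# * b + 1# * m
        ≈⟨ +-congˡ (*-identityˡ m) ⟩
      6# * b + m ∎))
    where
    open ≤-Reasoning
    6# = fromℕ 6
    0≤ν = <⇒≤ 0<ν
    δ = 6# ⁻¹ - ε
    0≤c : 0# ≤ c
    0≤c = ≤-trans 0≤1 1≤c
    0≤ccm : 0# ≤ (c * c) * m
    0≤ccm = *-nonNegative (*-nonNegative 0≤c 0≤c) 0≤m
    νt≤ : ν * t ≤ ν * (x + x) + (c * w + c * w)
    νt≤ = linear (+-mono-≤ (*-monoˡ-≤ 0≤ν t≤) (+-mono-≤ p≤ q≤))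
      (solve 8 (λ ν t x p₁ p₂ q₁ q₂ cw →
         ν :* t :+ (ν :* ((p₁ :+ p₂) :+ (q₁ :+ q₂)) :+ ((ν :* (x :+ x) :+ cw) :+ (ν :* (x :+ x) :+ cw)))
         := (ν :* (x :+ x) :+ (cw :+ cw)) :+ (ν :* (t :+ (x :+ x)) :+ (ν :* (p₁ :+ p₂) :+ ν :* (q₁ :+ q₂))))
         ≈-refl ν t x p₁ p₂ q₁ q₂ (c * w))
    -- Of the six errors `c * w`, one comes from `S`, one from `T`, and two from each of the two
    -- copies of `νt≤`.
    νm≤ : ν * m ≤ 6# * (ν * b) + 6# * (c * w)
    νm≤ = linear (+-mono-≤ (+-mono-≤ (*-monoˡ-≤ 0≤ν m≤) (+-mono-≤ (*-nonNegative 0≤ν 0≤v₂) (+-mono-≤ u≤ v≤)))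
                           (+-mono-≤ (+-mono-≤ νt≤ νt≤) (+-mono-≤ (*-monoˡ-≤ 0≤ν (+-mono-≤ s≤b s≤b))
                              (*-monoˡ-≤ 0≤ν (+-mono-≤ (+-mono-≤ x≤b x≤b) (+-mono-≤ x≤b x≤b))))))
      (solve 11 (λ ν m b s t x u₁ u₂ v₁ v₂ cw →
         ν :* m :+ ((ν :* ((u₁ :+ u₂) :+ v₁) :+ (ν :* v₂ :+ ((ν :* (s :+ s) :+ cw) :+ (ν :* (t :+ t) :+ cw))))
           :+ (((ν :* (x :+ x) :+ (cw :+ cw)) :+ (ν :* (x :+ x) :+ (cw :+ cw)))
                :+ (ν :* (b :+ b) :+ ν :* ((b :+ b) :+ (b :+ b)))))
         := (numeral 6 :* (ν :* b) :+ numeral 6 :* cw)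
           :+ ((ν :* m :+ (con 0 :+ (ν :* (u₁ :+ u₂) :+ ν :* (v₁ :+ v₂))))
             :+ ((ν :* t :+ ν :* t) :+ (ν :* (s :+ s) :+ ν :* ((x :+ x) :+ (x :+ x))))))
         ≈-refl ν m b s t x u₁ u₂ v₁ v₂ (c * w))
    -- 1 ≤ c turns the factor 1 + c into at most 2 c, whence the constant 4.
    cw≤ : c * w ≤ fromℕ 4 * ((c * c) * m)
    cw≤ = linear (+-mono-≤ (*-monoˡ-≤ 0≤c w≤) (*-monoˡ-≤ (*-nonNegative 0≤c (+-mono-0≤ 0≤m 0≤m)) 1≤c))
      (solve 3 (λ c w m → c :* w :+ (c :* ((con 1 :+ c) :* (m :+ m)) :+ (c :* (m :+ m)) :* c)
         := numeral 4 :* ((c :* c) :* m) :+ (c :* w :+ (c :* (m :+ m)) :* con 1)) ≈-refl c w m)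
      where
      +-mono-0≤ : ∀ {y z} → 0# ≤ y → 0# ≤ z → 0# ≤ y + z
      +-mono-0≤ 0≤y 0≤z = ≤-trans (≤-reflexive (≈-sym (+-identityʳ 0#))) (+-mono-≤ 0≤y 0≤z)
    m≤6b+6εm : m ≤ 6# * b + 6# * (ε * m)
    m≤6b+6εm = *-cancelˡ-≤ 0<ν (linear
      (+-mono-≤ νm≤ (*-monoˡ-≤ (0≤fromℕ 6) (+-mono-≤ cw≤ (*-monoˡ-≤ 0≤ccm 4≤κε))))
      (≈-trans (solve 9 (λ ν m b cw cc κ ε four six →
         ν :* m :+ ((six :* (ν :* b) :+ six :* cw) :+ six :* (four :* (cc :* m) :+ (cc :* m) :* (κ :* ε)))
         := ((ν :* (six :* b)) :+ (κ :* cc) :* (six :* (ε :* m))) :+ (ν :* m :+ six :* (cw :+ (cc :* m) :* four)))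
         ≈-refl ν m b (c * w) (c * c) κ ε (fromℕ 4) 6#)
       (+-congʳ (≈-trans (+-congˡ (*-congʳ (≈-sym ν≈))) (≈-sym (distribˡ ν (6# * b) (6# * (ε * m))))))))

-- Approximate local optima of a submodular function over bases.

module LocalOptima (R : Reals) {n : ℕ} (M : Matroid n) where
  open OrderedField R
  open SetFunctions R using (Submodular; NonNegative)
  open Matroid M
  open MatroidProperties M

  -- The tolerance is w / ν with the denominator cleared, matching the comparison that the program
  -- makes.
  LocalOptimum : (Subset n → ℝ) → Subset n → ℝ → ℝ → Subset n → Set
  LocalOptimum h K ν w X = ∀ {x y} → x ∈ X → x ∉ K → y ∉ X → Indep ((X ─ ⁅ x ⁆) ∪ ⁅ y ⁆) →
                           ν * h ((X ─ ⁅ x ⁆) ∪ ⁅ y ⁆) ≤ ν * h X + w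

  submodular-≤ : ∀ {h : Subset n → ℝ} → Submodular h → ∀ S T {U V} → S ∪ T ≡ U → S ∩ T ≡ V → h U + h V ≤ h S + h T
  submodular-≤ sub S T ≡.refl ≡.refl = sub S T

  module _ {h : Subset n → ℝ} (sub : Submodular h) {K : Subset n} {ν w : ℝ} (0≤ν : 0# ≤ ν) where

    -- Walks from C to X by symmetric exchanges: each brings into C an element
    -- x of X in place of some c that may also replace x in X.
    local-optimum-walk : ∀ {X} → IsBase X → K ⊆ X → LocalOptimum h K ν w X →
      ∀ k {C} → IsBase C → K ⊆ C → ∣ X ─ C ∣ ≡ k →
      ν * (h (X ∪ C) + h (X ∩ C)) ≤ ν * (h X + h X) + k · w
    local-optimum-walk {X} baseX K⊆X opt k {C} baseC K⊆C eq with ⊆-or-outside X C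
    local-optimum-walk {X} baseX K⊆X opt k {C} baseC K⊆C eq | inj₁ X⊆C
      with ≡.refl ← proj₂ baseX C (proj₁ baseC) X⊆C
      with k | ≡.trans (≡.sym eq) (≡.trans (cong ∣_∣ (solve≡ [] (x₀ ∖ x₀) ø (X ∷ []) [])) (∣⊥∣≡0 n))
    ... | zero | _ = ≤-reflexive (≈-trans
      (*-congˡ (+-cong (≈-reflexive (cong h (∪-idem X))) (≈-reflexive (cong h (∩-idem X)))))
      (≈-sym (+-identityʳ _)))
    local-optimum-walk {X} baseX K⊆X opt zero {C} baseC K⊆C eq | inj₂ (x , x∈X , x∉C) =
      contradiction (≡.trans (∣-∣ (x∈p∧x∉q⇒x∈p─q x∈X x∉C)) eq) λ ()
    local-optimum-walk {X} baseX K⊆X opt (suc k) {C} baseC K⊆C eq | inj₂ (x , x∈X , x∉C)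
      with c , c∈C , c∉X , indC′ , indX′ ← SymmetricExchange.exchange-pair baseX baseC x∈X x∉C =
      linear
        (+-mono-≤ (+-mono-≤ (*-monoˡ-≤ 0≤ν join) (*-monoˡ-≤ 0≤ν meet))
                  -- The element `x` is not frozen, because it lies outside `C ⊇ K`; this is why
                  -- only bases containing `K` can be compared with `X`.
                  (+-mono-≤ (opt x∈X (λ x∈K → x∉C (K⊆C x∈K)) c∉X indX′) hypothesis))
        (solve 10 (λ ν u i e d x u′ i′ w kw →
             ν :* (u :+ i) :+ ((ν :* (e :+ u′) :+ ν :* (d :+ i′)) :+ ((ν :* x :+ w) :+ (ν :* (x :+ x) :+ kw)))
          := (ν :* (x :+ x) :+ (w :+ kw)) :+ ((ν :* (u :+ d) :+ ν :* (x :+ i)) :+ (ν :* e :+ ν :* (u′ :+ i′))))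
          ≈-refl ν (h (X ∪ C)) (h (X ∩ C)) (h X′) (h (X ─ ⁅ x ⁆)) (h X) (h (X ∪ C′)) (h (X ∩ C′)) w (k · w))
      where
      C′ = (C ─ ⁅ c ⁆) ∪ ⁅ x ⁆
      X′ = (X ─ ⁅ x ⁆) ∪ ⁅ c ⁆
      sets = X ∷ C ∷ ⁅ x ⁆ ∷ ⁅ c ⁆ ∷ []
      facts = ∈⇒⁅⁆⊆ x∈X ∷ ∉⇒⁅⁆∩⊆⊥ x∉C ∷ ∈⇒⁅⁆⊆ c∈C ∷ ∉⇒⁅⁆∩⊆⊥ c∉X ∷ []
      hyps = (x₂ ⊑ x₀) ∷ (x₂ ⊓ x₁ ⊑ ø) ∷ (x₃ ⊑ x₁) ∷ (x₃ ⊓ x₀ ⊑ ø) ∷ []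
      -- In the sum of `join` and `meet` the term `h (X ─ ⁅ x ⁆)` cancels, leaving h(X ∪ C) + h(X ∩
      -- C) + h(X) ≤ h(X′) + h(X ∪ C′) + h(X ∩ C′). Local optimality bounds h(X′) by h(X), so going
      -- from `C′` back to `C` costs a single `w` on the scaled side.
      join : h (X ∪ C) + h (X ─ ⁅ x ⁆) ≤ h X′ + h (X ∪ C′)
      join = submodular-≤ {h} sub X′ (X ∪ C′)
        (solve≡ hyps (((x₀ ∖ x₂) ⊔ x₃) ⊔ (x₀ ⊔ ((x₁ ∖ x₃) ⊔ x₂))) (x₀ ⊔ x₁) sets facts)
        (solve≡ hyps (((x₀ ∖ x₂) ⊔ x₃) ⊓ (x₀ ⊔ ((x₁ ∖ x₃) ⊔ x₂))) (x₀ ∖ x₂) sets facts)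
      meet : h X + h (X ∩ C) ≤ h (X ─ ⁅ x ⁆) + h (X ∩ C′)
      meet = submodular-≤ {h} sub (X ─ ⁅ x ⁆) (X ∩ C′)
        (solve≡ hyps ((x₀ ∖ x₂) ⊔ (x₀ ⊓ ((x₁ ∖ x₃) ⊔ x₂))) x₀ sets facts)
        (solve≡ hyps ((x₀ ∖ x₂) ⊓ (x₀ ⊓ ((x₁ ∖ x₃) ⊔ x₂))) (x₀ ⊓ x₁) sets facts)
      hypothesis : ν * (h (X ∪ C′) + h (X ∩ C′)) ≤ ν * (h X + h X) + k · w
      hypothesis = local-optimum-walk baseX K⊆X opt k
        (largest⇒base baseC indC′ (ℕ.≤-reflexive (≡.sym
          (≡.trans (∣∪⁅⁆∣ {S = C ─ ⁅ c ⁆} (λ x∈ → x∉C (p─q⊆p C ⁅ c ⁆ x∈))) (∣-∣ c∈C)))))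
        (λ y∈K → solve⊆ ((x₀ ⊑ x₁) ∷ (x₀ ⊑ x₂) ∷ (x₃ ⊓ x₂ ⊑ ø) ∷ []) x₀ ((x₁ ∖ x₃) ⊔ x₄)
          (K ∷ C ∷ X ∷ ⁅ c ⁆ ∷ ⁅ x ⁆ ∷ []) (K⊆C ∷ K⊆X ∷ ∉⇒⁅⁆∩⊆⊥ c∉X ∷ []) y∈K)
        (ℕ.suc-injective (≡.trans
          (cong suc (cong ∣_∣ (solve≡ hyps (x₀ ∖ ((x₁ ∖ x₃) ⊔ x₂)) ((x₀ ∖ x₁) ∖ x₂) sets facts)))
          (≡.trans (∣-∣ (x∈p∧x∉q⇒x∈p─q x∈X x∉C)) eq)))

    local-optimum-≤ : 0# ≤ w → ∀ {X C} → IsBase X → K ⊆ X → LocalOptimum h K ν w X → IsBase C → K ⊆ C →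
                      ν * (h (X ∪ C) + h (X ∩ C)) ≤ ν * (h X + h X) + fromℕ n * w
    local-optimum-≤ 0≤w {X} {C} baseX K⊆X opt baseC K⊆C = ≤-trans
      (local-optimum-walk baseX K⊆X opt _ baseC K⊆C ≡.refl)
      (+-mono-≤ ≤-refl (≤-trans (·-monoˡ-≤ 0≤w (∣p∣≤n (X ─ C))) (≤-reflexive (·≈* n w))))

-- Algorithms are written in a total language of loops over the ground set and
-- compiled to programs; polynomial running time is then structural.

data Sort : Set where
  elem real set : Sort

Context : Set
Context = List Sort

infix 4 _∋_

data _∋_ : Context → Sort → Set where
  zero : ∀ {Γ τ} → τ ∷ Γ ∋ τ
  suc  : ∀ {Γ σ τ} → Γ ∋ τ → σ ∷ Γ ∋ τ

data Term (Γ : Context) : Sort → Set where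
  var           : ∀ {τ} → Γ ∋ τ → Term Γ τ
  let′          : ∀ {σ τ} → Term Γ σ → Term (σ ∷ Γ) τ → Term Γ τ
  empty         : Term Γ set
  insert remove : Γ ∋ elem → Term Γ set → Term Γ set
  zeroℝ         : Term Γ real
  add           : Term Γ real → Term Γ real → Term Γ real
  value         : Term Γ set → Term Γ real
  if-member     : ∀ {τ} → Γ ∋ elem → Term Γ set → Term Γ τ → Term Γ τ → Term Γ τ
  if-indep      : ∀ {τ} → Term Γ set → Term Γ τ → Term Γ τ → Term Γ τ
  if-leq        : ∀ {τ} → Term Γ real → Term Γ real → Term Γ τ → Term Γ τ → Term Γ τ
  for-each      : ∀ {τ} → Term Γ τ → Term (τ ∷ elem ∷ Γ) τ → Term Γ τ

Layout : Context → Set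
Layout Γ = ∀ {τ} → Γ ∋ τ → ℕ

infixl 5 _▹_

_▹_ : ∀ {Γ σ} → Layout Γ → ℕ → Layout (σ ∷ Γ)
(ρ ▹ r) zero    = r
(ρ ▹ r) (suc x) = ρ x

copy : Sort → ℕ → ℕ → Instruction
copy elem a b = copyℕ (direct a) (direct b)
copy real a b = copyℝ (direct a) (direct b)
copy set  a b = copyS (direct a) (direct b)

-- Register `d` holds the accumulator, natural register `1 + d` the counter, and register `2 + d`
-- the result of the body. Once that result is copied down, natural register `2 + d` is free to hold
-- the constant 1.
loop : Sort → ℕ → Program → Program
loop τ d body = while′ (negate (leqℕ (direct 0) (direct (1 ℕ.+ d))))
  (body ⨾ do′ (copy τ d (2 ℕ.+ d)) ⨾
   do′ (constℕ (direct (2 ℕ.+ d)) 1) ⨾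
   do′ (addℕ (direct (1 ℕ.+ d)) (direct (1 ℕ.+ d)) (direct (2 ℕ.+ d))))

-- compile t ρ d leaves the value of t in register d of its sort, and changes
-- no register below d.
compile : ∀ {Γ τ} → Term Γ τ → Layout Γ → ℕ → Program
compile {τ = τ} (var x) ρ d = do′ (copy τ d (ρ x))
compile {τ = τ} (let′ s t) ρ d =
  compile s ρ d ⨾ compile t (ρ ▹ d) (1 ℕ.+ d) ⨾ do′ (copy τ d (1 ℕ.+ d))
compile empty ρ d = do′ (emptyS (direct d))
compile (insert x s) ρ d = compile s ρ d ⨾ do′ (insertS (direct d) (direct (ρ x)))
compile (remove x s) ρ d = compile s ρ d ⨾ do′ (removeS (direct d) (direct (ρ x)))
compile zeroℝ ρ d = do′ (zeroℝ (direct d))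
compile (add s t) ρ d =
  compile s ρ d ⨾ compile t ρ (1 ℕ.+ d) ⨾ do′ (addℝ (direct d) (direct d) (direct (1 ℕ.+ d)))
compile (value s) ρ d = compile s ρ d ⨾ do′ (value (direct d) (direct d))
compile (if-member x s t u) ρ d =
  compile s ρ d ⨾ if′ (memberS (direct d) (direct (ρ x))) (compile t ρ d) (compile u ρ d)
compile (if-indep s t u) ρ d =
  compile s ρ d ⨾ if′ (indepS (direct d)) (compile t ρ d) (compile u ρ d)
compile (if-leq r s t u) ρ d =
  compile r ρ d ⨾ compile s ρ (1 ℕ.+ d) ⨾
  if′ (leqℝ (direct d) (direct (1 ℕ.+ d))) (compile t ρ d) (compile u ρ d)
compile {τ = τ} (for-each s t) ρ d =
  compile s ρ d ⨾ do′ (constℕ (direct (1 ℕ.+ d)) 0) ⨾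
  loop τ d (compile t (ρ ▹ (1 ℕ.+ d) ▹ d) (2 ℕ.+ d))

-- Natural register 0 holds n, which every loop reads, so evaluation starts at register 1 and the
-- answer is moved to set register 0 at the end.
program : Term [] set → Program
program t = compile t (λ ()) 1 ⨾ do′ (copyS (direct 0) (direct 1))

-- An upper bound: a conditional is charged for both branches, so that closure of polynomial bounds
-- under sums and under multiplication by n suffices.
cost : ∀ {Γ τ} → Term Γ τ → ℕ → ℕ
cost (var x)             n = 1
cost (let′ s t)          n = cost s n ℕ.+ (cost t n ℕ.+ 1)
cost empty               n = 1
cost (insert x s)        n = cost s n ℕ.+ 1
cost (remove x s)        n = cost s n ℕ.+ 1
cost zeroℝ               n = 1
cost (add s t)           n = cost s n ℕ.+ (cost t n ℕ.+ 1)
cost (value s)           n = cost s n ℕ.+ 1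
cost (if-member x s t u) n = cost s n ℕ.+ suc (cost t n ℕ.+ cost u n)
cost (if-indep s t u)    n = cost s n ℕ.+ suc (cost t n ℕ.+ cost u n)
cost (if-leq r s t u)    n = cost r n ℕ.+ (cost s n ℕ.+ suc (cost t n ℕ.+ cost u n))
cost (for-each s t)      n = cost s n ℕ.+ (1 ℕ.+ suc (n ℕ.* suc (cost t n ℕ.+ 3)))

polynomial-const : ∀ c → PolynomiallyBounded (λ _ → c)
polynomial-const c = c , 0 , λ n → ℕ.≤-reflexive (sym (ℕ.*-identityʳ c))

polynomial-+ : ∀ {S T} → PolynomiallyBounded S → PolynomiallyBounded T →
               PolynomiallyBounded (λ n → S n ℕ.+ T n)
polynomial-+ {S} {T} (a , j , S≤) (b , k , T≤) = a ℕ.+ b , j ℕ.+ k , λ n → begin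
  S n ℕ.+ T n
    ≤⟨ ℕ.+-mono-≤ (S≤ n) (T≤ n) ⟩
  a ℕ.* suc n ℕ.^ j ℕ.+ b ℕ.* suc n ℕ.^ k
    ≤⟨ ℕ.+-mono-≤ (ℕ.*-monoʳ-≤ a (ℕ.^-monoʳ-≤ (suc n) (ℕ.m≤m+n j k)))
                  (ℕ.*-monoʳ-≤ b (ℕ.^-monoʳ-≤ (suc n) (ℕ.m≤n+m k j))) ⟩
  a ℕ.* suc n ℕ.^ (j ℕ.+ k) ℕ.+ b ℕ.* suc n ℕ.^ (j ℕ.+ k)
    ≡⟨ ℕ.*-distribʳ-+ (suc n ℕ.^ (j ℕ.+ k)) a b ⟨
  (a ℕ.+ b) ℕ.* suc n ℕ.^ (j ℕ.+ k) ∎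
  where open ℕ.≤-Reasoning

polynomial-n* : ∀ {T} → PolynomiallyBounded T → PolynomiallyBounded (λ n → n ℕ.* T n)
polynomial-n* {T} (a , k , T≤) = a , suc k , λ n → begin
  n ℕ.* T n                     ≤⟨ ℕ.*-mono-≤ (ℕ.n≤1+n n) (T≤ n) ⟩
  suc n ℕ.* (a ℕ.* suc n ℕ.^ k) ≡⟨ ℕ.*-assoc (suc n) a _ ⟨
  suc n ℕ.* a ℕ.* suc n ℕ.^ k   ≡⟨ cong (ℕ._* suc n ℕ.^ k) (ℕ.*-comm (suc n) a) ⟩
  a ℕ.* suc n ℕ.* suc n ℕ.^ k   ≡⟨ ℕ.*-assoc a (suc n) _ ⟩
  a ℕ.* suc n ℕ.^ suc k         ∎
  where open ℕ.≤-Reasoning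

polynomial-cost : ∀ {Γ τ} (t : Term Γ τ) → PolynomiallyBounded (cost t)
polynomial-cost (var x)      = polynomial-const 1
polynomial-cost (let′ s t)   =
  polynomial-+ (polynomial-cost s) (polynomial-+ (polynomial-cost t) (polynomial-const 1))
polynomial-cost empty        = polynomial-const 1
polynomial-cost (insert x s) = polynomial-+ (polynomial-cost s) (polynomial-const 1)
polynomial-cost (remove x s) = polynomial-+ (polynomial-cost s) (polynomial-const 1)
polynomial-cost zeroℝ        = polynomial-const 1
polynomial-cost (add s t)    =
  polynomial-+ (polynomial-cost s) (polynomial-+ (polynomial-cost t) (polynomial-const 1))
polynomial-cost (value s)    = polynomial-+ (polynomial-cost s) (polynomial-const 1)
polynomial-cost (if-member x s t u) =
  polynomial-+ (polynomial-cost s)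
    (polynomial-+ (polynomial-const 1) (polynomial-+ (polynomial-cost t) (polynomial-cost u)))
polynomial-cost (if-indep s t u)    =
  polynomial-+ (polynomial-cost s)
    (polynomial-+ (polynomial-const 1) (polynomial-+ (polynomial-cost t) (polynomial-cost u)))
polynomial-cost (if-leq r s t u)    =
  polynomial-+ (polynomial-cost r) (polynomial-+ (polynomial-cost s)
    (polynomial-+ (polynomial-const 1) (polynomial-+ (polynomial-cost t) (polynomial-cost u))))
polynomial-cost (for-each s t)      =
  polynomial-+ (polynomial-cost s) (polynomial-+ (polynomial-const 2)
    (polynomial-n* (polynomial-+ (polynomial-const 1) (polynomial-+ (polynomial-cost t) (polynomial-const 3)))))

-- Semantics of terms, and correctness of the compiler.

module Evaluation (R : Reals) {n : ℕ} (M : Matroid n) (f : Subset n → Reals.ℝ R) where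
  open Reals R using (ℝ; 0#; _+_; _≤?_)
  open Matroid M using (indep?)

  Value : Sort → Set
  Value elem = Fin n
  Value real = ℝ
  Value set  = Subset n

  Environment : Context → Set
  Environment Γ = ∀ {τ} → Γ ∋ τ → Value τ

  infixl 5 _▸_

  _▸_ : ∀ {Γ σ} → Environment Γ → Value σ → Environment (σ ∷ Γ)
  (γ ▸ v) zero    = v
  (γ ▸ v) (suc x) = γ x

  eval : ∀ {Γ τ} → Term Γ τ → Environment Γ → Value τ
  eval (var x)             γ = γ x
  eval (let′ s t)          γ = eval t (γ ▸ eval s γ)
  eval empty               γ = ⊥
  eval (insert x s)        γ = eval s γ ∪ ⁅ γ x ⁆
  eval (remove x s)        γ = eval s γ ─ ⁅ γ x ⁆
  eval zeroℝ               γ = 0#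
  eval (add s t)           γ = eval s γ + eval t γ
  eval (value s)           γ = f (eval s γ)
  eval (if-member x s t u) γ = if does (γ x ∈? eval s γ) then eval t γ else eval u γ
  eval (if-indep s t u)    γ = if does (indep? (eval s γ)) then eval t γ else eval u γ
  eval (if-leq r s t u)    γ = if does (eval r γ ≤? eval s γ) then eval t γ else eval u γ
  eval (for-each s t)      γ = foldl (λ v i → eval t (γ ▸ i ▸ v)) (eval s γ) {n} (λ i → i)

module Correctness (R : Reals) {n : ℕ} (M : Matroid n) (f : Subset n → Reals.ℝ R) where
  open Reals R using (ℝ; 0#; _+_; _≤?_)
  open Matroid M using (indep?)
  open Machine R {n} hiding (set; real)
  open Semantics M f
  open Evaluation R M f

  module _ {A : Set} (m : ℕ → A) (v : A) where

    ↦-same : ∀ k → (m [ k ↦ v ]) k ≡ v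
    ↦-same k = cong (λ b → if b then v else m k) (Equivalence.to T-≡ (ℕ.≡⇒≡ᵇ k k refl))

    ↦-other : ∀ {j k} → j ≢ k → (m [ k ↦ v ]) j ≡ m j
    ↦-other {j} {k} j≢k with j ℕ.≡ᵇ k in eq
    ... | false = refl
    ... | true  = contradiction (ℕ.≡ᵇ⇒≡ j k (Equivalence.from T-≡ eq)) j≢k

  put-toℕ : ∀ i b (S : Subset n) → put (toℕ i) b S ≡ S [ i ]≔ b
  put-toℕ i b S with toℕ i ℕ.<? n
  ... | yes i<n = cong (λ j → S [ j ]≔ b) (fromℕ<-toℕ i i<n)
  ... | no  i≮n = contradiction (toℕ<n i) i≮n

  get-toℕ : ∀ i (S : Subset n) → get (toℕ i) S ≡ lookup S i
  get-toℕ i S with toℕ i ℕ.<? n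
  ... | yes i<n = cong (lookup S) (fromℕ<-toℕ i i<n)
  ... | no  i≮n = contradiction (toℕ<n i) i≮n

  ≔inside : ∀ {m} (S : Subset m) i → S [ i ]≔ inside ≡ S ∪ ⁅ i ⁆
  ≔inside (true  ∷ S) zero    = cong (true ∷_) (sym (∪-identityʳ S))
  ≔inside (false ∷ S) zero    = cong (true ∷_) (sym (∪-identityʳ S))
  ≔inside (true  ∷ S) (suc i) = cong (true ∷_) (≔inside S i)
  ≔inside (false ∷ S) (suc i) = cong (false ∷_) (≔inside S i)

  ≔outside : ∀ {m} (S : Subset m) i → S [ i ]≔ outside ≡ S ─ ⁅ i ⁆
  ≔outside (true  ∷ S) zero    = cong (false ∷_) (sym (p─⊥≡p S))
  ≔outside (false ∷ S) zero    = cong (false ∷_) (sym (p─⊥≡p S))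
  ≔outside (b     ∷ S) (suc i) = cong (b ∷_) (≔outside S i)

  lookup≡∈? : ∀ {m} (S : Subset m) i → lookup S i ≡ does (i ∈? S)
  lookup≡∈? (true  ∷ S) zero    = refl
  lookup≡∈? (false ∷ S) zero    = refl
  lookup≡∈? (_     ∷ S) (suc i) = lookup≡∈? S i

  Raw : Sort → Set
  Raw elem = ℕ
  Raw real = ℝ
  Raw set  = Subset n

  raw : ∀ τ → Value τ → Raw τ
  raw elem i = toℕ i
  raw real x = x
  raw set  S = S

  read : ∀ τ → State → ℕ → Raw τ
  read elem = nats
  read real = reals
  read set  = sets

  write : ∀ τ → State → ℕ → Raw τ → State
  write elem σ k = setNat  σ (direct k)
  write real σ k = setReal σ (direct k)
  write set  σ k = setSet  σ (direct k)

  read-write : ∀ τ σ k v → read τ (write τ σ k v) k ≡ v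
  read-write elem σ k v = ↦-same (nats σ) v k
  read-write real σ k v = ↦-same (reals σ) v k
  read-write set  σ k v = ↦-same (sets σ) v k

  write-other : ∀ τ σ {j k} v → j ≢ k → nats (write τ σ k v) j ≡ nats σ j
  write-other elem σ v j≢k = ↦-other (nats σ) v j≢k
  write-other real σ v j≢k = refl
  write-other set  σ v j≢k = refl

  execute-copy : ∀ τ a b σ → execute (copy τ a b) σ ≡ write τ σ a (read τ σ b)
  execute-copy elem a b σ = refl
  execute-copy real a b σ = refl
  execute-copy set  a b σ = refl

  Preserves : ℕ → State → State → Set
  Preserves d σ υ = ∀ τ j → j ℕ.< d → read τ υ j ≡ read τ σ j

  preserves-trans : ∀ {d σ υ φ} → Preserves d σ υ → Preserves d υ φ → Preserves d σ φ
  preserves-trans p q τ j j<d = trans (q τ j j<d) (p τ j j<d)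

  preserves-≤ : ∀ {c d σ υ} → c ℕ.≤ d → Preserves d σ υ → Preserves c σ υ
  preserves-≤ c≤d p τ j j<c = p τ j (ℕ.<-≤-trans j<c c≤d)

  preserves-write : ∀ τ {d} σ k v → d ℕ.≤ k → Preserves d σ (write τ σ k v)
  preserves-write elem σ k v d≤k elem j j<d = ↦-other (nats σ) v (ℕ.<⇒≢ (ℕ.<-≤-trans j<d d≤k))
  preserves-write elem σ k v d≤k real j j<d = refl
  preserves-write elem σ k v d≤k set  j j<d = refl
  preserves-write real σ k v d≤k elem j j<d = refl
  preserves-write real σ k v d≤k real j j<d = ↦-other (reals σ) v (ℕ.<⇒≢ (ℕ.<-≤-trans j<d d≤k))
  preserves-write real σ k v d≤k set  j j<d = refl
  preserves-write set  σ k v d≤k elem j j<d = refl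
  preserves-write set  σ k v d≤k real j j<d = refl
  preserves-write set  σ k v d≤k set  j j<d = ↦-other (sets σ) v (ℕ.<⇒≢ (ℕ.<-≤-trans j<d d≤k))

  record Run (p : Program) (σ : State) (c d : ℕ) (Post : State → Set) : Set where
    constructor mkRun
    field
      {after}   : State
      {time}    : ℕ
      halts     : ⟨ p , σ ⟩⇓[ time ] after
      time≤     : time ℕ.≤ c
      preserves : Preserves d σ after
      post      : Post after

  Holds : ℕ → ∀ τ → Value τ → State → Set
  Holds d τ v σ = read τ σ d ≡ raw τ v

  infixr 4 _then_

  _then_ : ∀ {p q σ b c d P Q} → Run p σ b d P →
           (∀ υ → Preserves d σ υ → P υ → Run q υ c d Q) → Run (p ⨾ q) σ (b ℕ.+ c) d Q
  mkRun e e≤ pe post then k with mkRun e′ e′≤ pe′ post′ ← k _ pe post =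
    mkRun (e ⨾ e′) (ℕ.+-mono-≤ e≤ e′≤) (preserves-trans pe pe′) post′

  -- A result one register up is kept together with the register below it.
  lower : ∀ {p σ c d P} → Run p σ c (suc d) P → Run p σ c d (λ υ → P υ × Preserves (suc d) σ υ)
  lower (mkRun e e≤ pe post) = mkRun e e≤ (preserves-≤ (ℕ.n≤1+n _) pe) (post , pe)

  run-write : ∀ {i σ} τ d k v → execute i σ ≡ write τ σ k v → d ℕ.≤ k →
              Run (do′ i) σ 1 d (λ υ → υ ≡ write τ σ k v)
  run-write τ d k v eq d≤k = mkRun do′ ℕ.≤-refl
    (subst (Preserves d _) (sym eq) (preserves-write τ _ k v d≤k)) eq

  run-result : ∀ {i σ} τ d {v} r → execute i σ ≡ write τ σ d r → r ≡ raw τ v →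
               Run (do′ i) σ 1 d (Holds d τ v)
  run-result {σ = σ} τ d r eq r≡ = mkRun do′ ℕ.≤-refl
    (subst (Preserves d _) (sym eq) (preserves-write τ _ d r ℕ.≤-refl))
    (trans (cong (λ υ → read τ υ d) eq) (trans (read-write τ σ d r) r≡))

  run-if : ∀ {p q σ a b d} τ v w c {β} → test c σ ≡ β →
           Run p σ a d (Holds d τ v) → Run q σ b d (Holds d τ w) →
           Run (if′ c p q) σ (suc (a ℕ.+ b)) d (Holds d τ (if β then v else w))
  run-if τ v w c {true}  eq (mkRun e e≤ pe post) _ =
    mkRun (if-true eq e)  (ℕ.s≤s (ℕ.m≤n⇒m≤n+o _ e≤)) pe post
  run-if τ v w c {false} eq _ (mkRun e e≤ pe post) =
    mkRun (if-false eq e) (ℕ.s≤s (ℕ.m≤n⇒m≤o+n _ e≤)) pe post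

  record Represents {Γ} (ρ : Layout Γ) (γ : Environment Γ) (d : ℕ) (σ : State) : Set where
    field
      0<d  : 0 ℕ.< d
      size : nats σ 0 ≡ n
      low  : ∀ {τ} (x : Γ ∋ τ) → ρ x ℕ.< d
      holds : ∀ {τ} (x : Γ ∋ τ) → Holds (ρ x) τ (γ x) σ
  open Represents

  module _ {Γ} {ρ : Layout Γ} {γ : Environment Γ} where

    represents-≤ : ∀ {c d σ} → c ℕ.≤ d → Represents ρ γ c σ → Represents ρ γ d σ
    represents-≤ c≤d r = record { 0<d = ℕ.<-≤-trans (0<d r) c≤d ; size = size r
      ; low = λ x → ℕ.<-≤-trans (low r x) c≤d ; holds = holds r }

    represents-preserved : ∀ {d σ υ} → Preserves d σ υ → Represents ρ γ d σ → Represents ρ γ d υ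
    represents-preserved p r = record { 0<d = 0<d r ; size = trans (p elem 0 (0<d r)) (size r)
      ; low = low r ; holds = λ {τ} x → trans (p τ _ (low r x)) (holds r x) }

    represents-▹ : ∀ {d k τ v σ} → k ℕ.< d → Holds k τ v σ → Represents ρ γ d σ →
                   Represents {τ ∷ Γ} (ρ ▹ k) (γ ▸ v) d σ
    represents-▹ {d} {k} {τ} {v} {σ} k<d h r = record { 0<d = 0<d r ; size = size r ; low = low′ ; holds = holds′ }
      where
      low′ : ∀ {τ′} (x : τ ∷ Γ ∋ τ′) → (ρ ▹ k) x ℕ.< d
      low′ zero    = k<d
      low′ (suc x) = low r x
      holds′ : ∀ {τ′} (x : τ ∷ Γ ∋ τ′) → Holds ((ρ ▹ k) x) τ′ ((γ ▸ v) x) σ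
      holds′ zero    = h
      holds′ (suc x) = holds r x

  module _ {Γ τ} {ρ : Layout Γ} {γ : Environment Γ} {d b : ℕ} {body : Program}
           {step : Value τ → Fin n → Value τ}
           (run-body : ∀ {σ v i} → Represents ρ γ d σ → Holds d τ v σ → Holds (1 ℕ.+ d) elem i σ →
                       Run body σ b (2 ℕ.+ d) (Holds (2 ℕ.+ d) τ (step v i))) where

    -- Generalised from the whole ground set to the elements `xs` still to come, those from the
    -- counter value `c` on. The machine counts up while `foldl` recurses on the vector, and the
    -- hypothesis on `xs` keeps the two in step.
    run-loop : ∀ m c (xs : Vector (Fin n) m) → (∀ i → toℕ (xs i) ≡ c ℕ.+ toℕ i) → c ℕ.+ m ≡ n →
               ∀ {σ v} → Represents ρ γ d σ → Holds d τ v σ → nats σ (1 ℕ.+ d) ≡ c →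
               Run (loop τ d body) σ (suc (m ℕ.* suc (b ℕ.+ 3))) d (Holds d τ (foldl step v xs))
    run-loop zero c xs xs≡ eq {σ} rep h counter = mkRun
      (while-false (cong not (trans (cong₂ ℕ._≤ᵇ_ (size rep) counter)
        (Equivalence.to T-≡ (ℕ.≤⇒≤ᵇ (ℕ.≤-reflexive (trans (sym eq) (ℕ.+-identityʳ c))))))))
      ℕ.≤-refl (λ _ _ _ → refl) h
    run-loop (suc m) c xs xs≡ eq {σ} {v} rep h counter = iterate
      where
      running : test (negate (leqℕ (direct 0) (direct (1 ℕ.+ d)))) σ ≡ true
      running with nats σ 0 ℕ.≤ᵇ nats σ (1 ℕ.+ d) in le
      ... | false = refl
      ... | true  = contradiction
        (subst₂ ℕ._≤_ (size rep) counter (ℕ.≤ᵇ⇒≤ _ _ (Equivalence.from T-≡ le)))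
        (ℕ.<⇒≱ (subst (c ℕ.<_) eq (ℕ.m<m+n c (ℕ.s≤s ℕ.z≤n))))
      iterate : Run (loop τ d body) σ (suc (suc m ℕ.* suc (b ℕ.+ 3))) d (Holds d τ (foldl step v xs))
      iterate
        with mkRun {σ₁} e₁ e₁≤ p₁ h₁ ← run-body {i = xs zero} rep h
               (trans counter (sym (trans (xs≡ zero) (ℕ.+-identityʳ c))))
        with mkRun {σ₂} e₂ e₂≤ p₂ refl ← run-write τ d d _ (execute-copy τ d (2 ℕ.+ d) σ₁) ℕ.≤-refl
        with mkRun {σ₃} e₃ e₃≤ p₃ refl ← run-write {constℕ (direct (2 ℕ.+ d)) 1} {σ₂} elem (2 ℕ.+ d) (2 ℕ.+ d) 1 refl ℕ.≤-refl
        with mkRun {σ₄} e₄ e₄≤ p₄ refl ← run-write {addℕ (direct (1 ℕ.+ d)) (direct (1 ℕ.+ d)) (direct (2 ℕ.+ d))} {σ₃}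
               elem (1 ℕ.+ d) (1 ℕ.+ d) _ refl ℕ.≤-refl
        with mkRun e₅ e₅≤ p₅ h₅ ← run-loop m (suc c) (λ i → xs (suc i)) (λ i → trans (xs≡ (suc i)) (ℕ.+-suc c (toℕ i)))
               (trans (sym (ℕ.+-suc c m)) eq) {σ₄} {step v (xs zero)}
               (represents-preserved
                 (preserves-trans (preserves-≤ (ℕ.m≤n+m d 2) p₁) (preserves-trans p₂
                   (preserves-trans (preserves-≤ (ℕ.m≤n+m d 2) p₃) (preserves-≤ (ℕ.n≤1+n d) p₄)))) rep)
               (trans (p₄ τ d ℕ.≤-refl) (trans (p₃ τ d (ℕ.n≤1+n _)) (trans (read-write τ σ₁ d _) h₁)))
               (trans (↦-same (nats σ₃) _ (1 ℕ.+ d))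
                 (trans (cong₂ ℕ._+_ {u = nats σ₃ (2 ℕ.+ d)} {v = 1}
                   (trans (p₃ elem (1 ℕ.+ d) ℕ.≤-refl) (trans (write-other τ σ₁ _ (ℕ.>⇒≢ (ℕ.n<1+n d))) (trans (p₁ elem (1 ℕ.+ d) ℕ.≤-refl) counter)))
                   (↦-same (nats σ₂) 1 (2 ℕ.+ d)))
                 (ℕ.+-comm c 1)))
        = mkRun (while-true running (e₁ ⨾ e₂ ⨾ e₃ ⨾ e₄) e₅)
            (ℕ.s≤s (ℕ.≤-trans
              (ℕ.+-mono-≤ (ℕ.+-mono-≤ e₁≤ (ℕ.+-mono-≤ e₂≤ (ℕ.+-mono-≤ e₃≤ e₄≤))) e₅≤)
              (ℕ.≤-reflexive (ℕ.+-suc (b ℕ.+ 3) _))))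
            (preserves-trans (preserves-≤ (ℕ.m≤n+m d 2) p₁) (preserves-trans p₂
              (preserves-trans (preserves-≤ (ℕ.m≤n+m d 2) p₃) (preserves-trans (preserves-≤ (ℕ.n≤1+n d) p₄) p₅))))
            h₅

  run-compile : ∀ {Γ τ} (t : Term Γ τ) {ρ : Layout Γ} {γ : Environment Γ} {d σ} → Represents ρ γ d σ →
                Run (compile t ρ d) σ (cost t n) d (Holds d τ (eval t γ))
  run-compile {τ = τ} (var x) {ρ} {γ} {d} {σ} rep =
    run-result τ d _ (execute-copy τ d (ρ x) σ) (holds rep x)
  run-compile {τ = τ} (let′ s t) {d = d} rep =
    run-compile s rep then λ σ₁ p₁ h₁ →
    lower (run-compile t (represents-▹ (ℕ.n<1+n d) h₁
      (represents-≤ (ℕ.n≤1+n d) (represents-preserved p₁ rep)))) then λ σ₂ _ (h₂ , _) →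
    run-result τ d _ (execute-copy τ d (1 ℕ.+ d) σ₂) h₂
  run-compile empty {d = d} rep = run-result set d _ refl refl
  run-compile (insert x s) {ρ} {γ} {d} rep =
    run-compile s rep then λ σ₁ p₁ h₁ →
    run-result set d _ refl (trans (cong₂ (λ k S → put k inside S)
      (trans (p₁ elem (ρ x) (low rep x)) (holds rep x)) h₁)
      (trans (put-toℕ (γ x) inside _) (≔inside _ (γ x))))
  run-compile (remove x s) {ρ} {γ} {d} rep =
    run-compile s rep then λ σ₁ p₁ h₁ →
    run-result set d _ refl (trans (cong₂ (λ k S → put k outside S)
      (trans (p₁ elem (ρ x) (low rep x)) (holds rep x)) h₁)
      (trans (put-toℕ (γ x) outside _) (≔outside _ (γ x))))
  run-compile zeroℝ {d = d} rep = run-result real d _ refl refl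
  run-compile (add s t) {d = d} rep =
    run-compile s rep then λ σ₁ p₁ h₁ →
    lower (run-compile t (represents-≤ (ℕ.n≤1+n d) (represents-preserved p₁ rep))) then λ σ₂ _ (h₂ , p₂) →
    run-result real d _ refl (cong₂ _+_ (trans (p₂ real d ℕ.≤-refl) h₁) h₂)
  run-compile (value s) {d = d} rep =
    run-compile s rep then λ σ₁ p₁ h₁ →
    run-result real d _ refl (cong f h₁)
  run-compile {τ = τ} (if-member x s t u) {ρ} {γ} {d} rep =
    run-compile s rep then λ σ₁ p₁ h₁ →
    run-if τ (eval t γ) (eval u γ) (memberS (direct d) (direct (ρ x)))
      (trans (cong₂ get (trans (p₁ elem (ρ x) (low rep x)) (holds rep x)) h₁)
        (trans (get-toℕ (γ x) (eval s γ)) (lookup≡∈? (eval s γ) (γ x))))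
      (run-compile t (represents-preserved p₁ rep)) (run-compile u (represents-preserved p₁ rep))
  run-compile {τ = τ} (if-indep s t u) {γ = γ} {d = d} rep =
    run-compile s rep then λ σ₁ p₁ h₁ →
    run-if τ (eval t γ) (eval u γ) (indepS (direct d)) (cong (λ S → does (indep? S)) h₁)
      (run-compile t (represents-preserved p₁ rep)) (run-compile u (represents-preserved p₁ rep))
  run-compile {τ = τ} (if-leq r s t u) {γ = γ} {d = d} rep =
    run-compile r rep then λ σ₁ p₁ h₁ →
    lower (run-compile s (represents-≤ (ℕ.n≤1+n d) (represents-preserved p₁ rep))) then λ σ₂ p₂ (h₂ , p₂′) →
    run-if τ (eval t γ) (eval u γ) (leqℝ (direct d) (direct (1 ℕ.+ d)))
      (cong₂ (λ x y → does (x ≤? y)) (trans (p₂′ real d ℕ.≤-refl) h₁) h₂)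
      (run-compile t (represents-preserved p₂ (represents-preserved p₁ rep)))
      (run-compile u (represents-preserved p₂ (represents-preserved p₁ rep)))
  run-compile {τ = τ} (for-each s t) {d = d} rep =
    run-compile s rep then λ σ₁ p₁ h₁ →
    lower (run-write elem (1 ℕ.+ d) (1 ℕ.+ d) 0 refl ℕ.≤-refl) then λ { σ₂ p₂ (refl , p₂′) →
    run-loop
      (λ rep′ h i≡ → run-compile t
        (represents-▹ (ℕ.m<n+m d (ℕ.s≤s ℕ.z≤n)) h (represents-▹ (ℕ.n<1+n (suc d)) i≡ (represents-≤ (ℕ.m≤n+m d 2) rep′))))
      n 0 (λ i → i) (λ _ → refl) refl
      (represents-preserved p₂ (represents-preserved p₁ rep))
      (trans (p₂′ τ d ℕ.≤-refl) h₁)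
      (↦-same (nats σ₁) 0 (1 ℕ.+ d)) }

  returns-eval : (t : Term [] set) → ∃[ s ] Returns (program t) (eval t (λ ())) s × s ℕ.≤ cost t n ℕ.+ 1
  returns-eval t
    with mkRun {σ} e e≤ p h ← run-compile t {λ ()} {λ ()} {1} {initial}
           (record { 0<d = ℕ.s≤s ℕ.z≤n ; size = refl ; low = λ () ; holds = λ () }) =
    _ , (_ , (e ⨾ do′) , h) , ℕ.+-mono-≤ e≤ ℕ.≤-refl

-- The algorithm as a term of the loop language.

set-difference : ∀ {Γ} → Γ ∋ set → Γ ∋ set → Term Γ set
set-difference S D = for-each (var S)
  (if-member (suc zero) (var (suc (suc D))) (remove (suc zero) (var zero)) (var zero))

greedy-base : ∀ {Γ} → Term Γ set
greedy-base = for-each empty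
  (if-indep (insert (suc zero) (var zero)) (insert (suc zero) (var zero)) (var zero))

-- An upper bound on the value of all independent sets.
total-weight : ∀ {Γ} → Term Γ real
total-weight = for-each (value empty)
  (if-indep (insert (suc zero) empty) (add (var zero) (value (insert (suc zero) empty))) (var zero))

-- The count depends on ε alone and not on n, so these repetitions may be written out in the program
-- text.
unroll : ∀ {Γ τ} → ℕ → Term Γ τ → Term (τ ∷ Γ) τ → Term Γ τ
unroll zero    s t = s
unroll (suc k) s t = unroll k (let′ s t) t

-- k * (n * n) repetitions; there is no multiplication, hence the nesting.
rounds : ∀ {Γ τ} → ℕ → Term Γ τ → Term (τ ∷ elem ∷ τ ∷ elem ∷ τ ∷ Γ) τ → Term Γ τ
rounds k s t = unroll k s (for-each (var zero) (for-each (var zero) t))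

shift₅ : ∀ {Γ a b c d e τ} → Γ ∋ τ → a ∷ b ∷ c ∷ d ∷ e ∷ Γ ∋ τ
shift₅ x = suc (suc (suc (suc (suc x))))

-- Multiplication by k n² through repeated addition: it lets a gain be compared with w / (k n²)
-- although the machine cannot divide.
scale : ∀ {Γ} → ℕ → Term Γ real → Term Γ real
scale k t = let′ t (rounds k zeroℝ (add (var (shift₅ zero)) (var zero)))

objective : ∀ {Γ} → Term Γ set → Γ ∋ set → Term Γ real
objective s D = let′ s (let′ (set-difference zero (suc D)) (value (var zero)))

try-swap : ∀ {Γ} → ℕ → (X D K : Γ ∋ set) → Γ ∋ real → (x y : Γ ∋ elem) → Term Γ set
try-swap k X D K w x y =
  if-member x (var K) (var X)
    (if-member x (var X)
      (if-member y (var X) (var X)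
        (if-indep swapped
          (if-leq (scale k (objective swapped D)) (add (scale k (objective (var X) D)) (var w))
            (var X) swapped)
          (var X)))
      (var X))
  where swapped = insert y (remove x (var X))

pass : ∀ {Γ} → ℕ → (X D K : Γ ∋ set) → Γ ∋ real → Term Γ set
pass k X D K w = for-each (var X) (for-each (var zero)
  (try-swap k zero (suc (suc (suc (suc D)))) (suc (suc (suc (suc K)))) (suc (suc (suc (suc w))))
            (suc (suc (suc zero))) (suc zero)))

local-search : ∀ {Γ} → ℕ → (X D K : Γ ∋ set) → Γ ∋ real → Term Γ set
local-search k X D K w = rounds k (var X) (pass k zero (shift₅ D) (shift₅ K) (shift₅ w))

-- The variables bound are, in this order, w, a greedy base, ∅, S, T, K and X.
algorithm : ℕ → Term [] set
algorithm k =
  let′ total-weight (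
  let′ greedy-base (
  let′ empty (
  let′ (local-search k (suc zero) zero zero (suc (suc zero))) (
  let′ (local-search k zero zero (suc zero) (suc (suc (suc zero)))) (
  let′ (set-difference zero (suc zero)) (
  -- `T` itself is a base containing `K`, hence an admissible start: `K` never has to be extended to
  -- a base.
  let′ (local-search k (suc zero) (suc (suc (suc zero))) zero (suc (suc (suc (suc (suc zero)))))) (
  if-leq (value (var (suc (suc (suc zero))))) (value (var zero)) (var zero) (var (suc (suc (suc zero)))))))))))

-- Iterations and folds.

iter : ∀ {A : Set} → ℕ → (A → A) → A → A
iter zero    φ a = a
iter (suc k) φ a = iter k φ (φ a)

module _ {A : Set} where

  iter-comm : ∀ k (φ : A → A) a → iter k φ (φ a) ≡ φ (iter k φ a)
  iter-comm zero    φ a = refl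
  iter-comm (suc k) φ a = iter-comm k φ (φ a)

  iter-+ : ∀ j k (φ : A → A) a → iter (j ℕ.+ k) φ a ≡ iter k φ (iter j φ a)
  iter-+ zero    k φ a = refl
  iter-+ (suc j) k φ a = iter-+ j k φ (φ a)

  iter-* : ∀ j k (φ : A → A) a → iter (j ℕ.* k) φ a ≡ iter j (iter k φ) a
  iter-* zero    k φ a = refl
  iter-* (suc j) k φ a = trans (iter-+ k (j ℕ.* k) φ a) (iter-* j k φ (iter k φ a))

  iter-cong : ∀ k {φ ψ : A → A} → (∀ a → φ a ≡ ψ a) → ∀ a → iter k φ a ≡ iter k ψ a
  iter-cong zero    eq a = refl
  iter-cong (suc k) {φ} {ψ} eq a = trans (iter-cong k eq (φ a)) (cong (iter k ψ) (eq a))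

  iter-fixed : ∀ k {φ : A → A} {a} → φ a ≡ a → iter k φ a ≡ a
  iter-fixed zero    eq = refl
  iter-fixed (suc k) {φ} eq = trans (cong (iter k φ) eq) (iter-fixed k eq)

  module _ {B : Set} where

    foldl-cong : ∀ {g g′ : A → B → A} → (∀ a b → g a b ≡ g′ a b) →
                 ∀ {m} a (xs : Vector B m) → foldl g a xs ≡ foldl g′ a xs
    foldl-cong eq {zero}  a xs = refl
    foldl-cong {g} {g′} eq {suc m} a xs =
      trans (foldl-cong eq (g a (xs zero)) (λ i → xs (suc i))) (cong (λ a → foldl g′ a (λ i → xs (suc i))) (eq a (xs zero)))

    foldl-const : ∀ (φ : A → A) {m} a (xs : Vector B m) → foldl (λ a _ → φ a) a xs ≡ iter m φ a
    foldl-const φ {zero}  a xs = refl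
    foldl-const φ {suc m} a xs = foldl-const φ (φ a) (λ i → xs (suc i))

    -- `Idle` speaks about one state, while the elements of a pass are tried at successive states.
    -- If no step changes anything these states coincide, so every element was found idle at the
    -- final one; otherwise the changes accumulate by transitivity. It is applied twice, to the
    -- inner and to the outer loop of a sweep.
    foldl-progress : {Inv : A → Set} {Idle : B → A → Set} {_≺_ : A → A → Set} →
      (∀ {a b c} → a ≺ b → b ≺ c → a ≺ c) → ∀ {g} →
      (∀ a b → Inv a → (g a b ≡ a × Idle b a) ⊎ (Inv (g a b) × a ≺ g a b)) →
      ∀ {m} a (xs : Vector B m) → Inv a →
      (foldl g a xs ≡ a × (∀ i → Idle (xs i) a)) ⊎ (Inv (foldl g a xs) × a ≺ foldl g a xs)
    foldl-progress ≺-trans step {zero} a xs inv = inj₁ (refl , λ ())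
    foldl-progress {Inv} {Idle} {_≺_} ≺-trans {g} step {suc m} a xs inv with step a (xs zero) inv
    ... | inj₁ (eq , idle) with foldl-progress {Inv} {Idle} {_≺_} ≺-trans {g} step a (λ i → xs (suc i)) inv
    ...   | inj₁ (eq′ , idles) = inj₁
      ( trans (cong (λ a → foldl g a (λ i → xs (suc i))) eq) eq′
      , λ { zero → idle ; (suc i) → idles i })
    ...   | inj₂ (inv′ , a≺) = inj₂ (subst (λ b → Inv b × a ≺ b)
      (cong (λ a → foldl g a (λ i → xs (suc i))) (sym eq)) (inv′ , a≺))
    foldl-progress {Inv} {Idle} {_≺_} ≺-trans {g} step {suc m} a xs inv | inj₂ (inv′ , a≺)
      with foldl-progress {Inv} {Idle} {_≺_} ≺-trans {g} step (g a (xs zero)) (λ i → xs (suc i)) inv′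
    ...   | inj₁ (eq′ , _)     = inj₂ (subst (λ b → Inv b × a ≺ b) (sym eq′) (inv′ , a≺))
    ...   | inj₂ (inv″ , a≺′) = inj₂ (inv″ , ≺-trans a≺ a≺′)

subset-unique : ∀ {n} → n ≡ 0 → (S T : Subset n) → S ≡ T
subset-unique refl [] [] = refl

-- Analysis of the algorithm.

module Analysis (R : Reals) {n : ℕ} (M : Matroid n) (f : Subset n → Reals.ℝ R) where
  open OrderedField R
  open Matroid M
  open MatroidProperties M
  open Evaluation R M f
  open SetFunctions R using (Submodular; NonNegative; IsMaximumOver)
  open LocalOptima R M

  foldl-difference : ∀ D {m} S (xs : Vector (Fin n) m) →
    ∀ {j} → (j ∈ foldl (λ v i → if does (i ∈? D) then v ─ ⁅ i ⁆ else v) S xs → j ∈ S × (∀ i → xs i ≡ j → j ∉ D))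
          × (j ∈ S → j ∉ D → j ∈ foldl (λ v i → if does (i ∈? D) then v ─ ⁅ i ⁆ else v) S xs)
  foldl-difference D {zero}  S xs = (λ j∈S → j∈S , λ ()) , λ j∈S _ → j∈S
  foldl-difference D {suc m} S xs {j} with xs zero ∈? D
  ... | yes x∈D with to , from ← foldl-difference D (S ─ ⁅ xs zero ⁆) (λ i → xs (suc i)) {j} =
    (λ j∈ → p─q⊆p S _ (proj₁ (to j∈)) , λ
      { zero refl _ → ∉⊥ (solve⊆ [] ((x₀ ∖ x₁) ⊓ x₁) ø (S ∷ ⁅ j ⁆ ∷ []) [] (x∈p∩q⁺ (proj₁ (to j∈) , x∈⁅x⁆ j)))
      ; (suc i) → proj₂ (to j∈) i })
    , λ j∈S j∉D → from (x∈p∧x∉q⇒x∈p─q j∈S (λ j∈⁅⁆ → j∉D (subst (_∈ D) (sym (x∈⁅y⁆⇒x≡y _ j∈⁅⁆)) x∈D))) j∉D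
  ... | no  x∉D with to , from ← foldl-difference D S (λ i → xs (suc i)) {j} =
    (λ j∈ → proj₁ (to j∈) , λ { zero refl → x∉D ; (suc i) → proj₂ (to j∈) i }) , from

  eval-set-difference : ∀ {Γ} (S D : Γ ∋ set) (γ : Environment Γ) → eval (set-difference S D) γ ≡ γ S ─ γ D
  eval-set-difference S D γ = ⊆-antisym
    (λ {j} j∈ → let j∈S , j∉D = proj₁ (foldl-difference (γ D) (γ S) (λ i → i)) j∈
                in x∈p∧x∉q⇒x∈p─q j∈S (j∉D j refl))
    (λ {j} j∈ → proj₂ (foldl-difference (γ D) (γ S) (λ i → i)) (p─q⊆p (γ S) (γ D) j∈)
      (λ j∈D → ∉⊥ (solve⊆ [] ((x₀ ∖ x₁) ⊓ x₁) ø (γ S ∷ γ D ∷ []) [] (x∈p∩q⁺ (j∈ , j∈D)))))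

  eval-unroll : ∀ {Γ τ} k (s : Term Γ τ) (t : Term (τ ∷ Γ) τ) (γ : Environment Γ) (φ : Value τ → Value τ) →
                (∀ v → eval t (γ ▸ v) ≡ φ v) → eval (unroll k s t) γ ≡ iter k φ (eval s γ)
  eval-unroll zero    s t γ φ eq = refl
  eval-unroll (suc k) s t γ φ eq = trans (eval-unroll k (let′ s t) t γ φ eq) (cong (iter k φ) (eq (eval s γ)))

  eval-rounds : ∀ {Γ τ} k (s : Term Γ τ) t (γ : Environment Γ) (φ : Value τ → Value τ) →
                (∀ a i b j v → eval t (γ ▸ a ▸ i ▸ b ▸ j ▸ v) ≡ φ v) →
                eval (rounds k s t) γ ≡ iter (k ℕ.* (n ℕ.* n)) φ (eval s γ)
  eval-rounds k s t γ φ eq = trans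
    (eval-unroll k s _ γ (iter (n ℕ.* n) φ) λ a → trans
      (foldl-cong (λ b i → trans (foldl-cong (λ v j → eq a i b j v) b (λ j → j)) (foldl-const φ {n} b (λ j → j))) a (λ i → i))
      (trans (foldl-const (iter n φ) {n} a (λ i → i)) (sym (iter-* n n φ a))))
    (sym (iter-* k (n ℕ.* n) φ _))

  iter-+≡· : ∀ k x → iter k (x +_) 0# ≡ k · x
  iter-+≡· zero    x = refl
  iter-+≡· (suc k) x = trans (iter-comm k (x +_) 0#) (cong (x +_) (iter-+≡· k x))

  eval-objective : ∀ {Γ} (s : Term Γ set) D (γ : Environment Γ) → eval (objective s D) γ ≡ f (eval s γ ─ γ D)
  eval-objective s D γ = cong f (eval-set-difference zero (suc D) (γ ▸ eval s γ))

  better : Subset n → Subset n → Subset n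
  better S X = if does (f S ≤? f X) then X else S

  better-preserves : ∀ {S X} → IsBase S → IsBase X → IsBase (better S X)
  better-preserves {S} {X} baseS baseX with does (f S ≤? f X)
  ... | true  = baseX
  ... | false = baseS

  better-≥ : ∀ S X → f S ≤ f (better S X) × f X ≤ f (better S X)
  better-≥ S X with f S ≤? f X
  ... | yes le = le , ≤-refl
  ... | no  gt = ≤-refl , <⇒≤ gt

  module Search (k : ℕ) where
    N : ℕ
    N = k ℕ.* (n ℕ.* n)

    eval-scale : ∀ {Γ} t (γ : Environment Γ) → eval (scale k t) γ ≡ N · eval t γ
    eval-scale t γ = trans (eval-rounds k zeroℝ _ (γ ▸ eval t γ) (eval t γ +_) (λ _ _ _ _ _ → refl)) (iter-+≡· N (eval t γ))

    module _ (D K : Subset n) (w : ℝ) where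
      h : Subset n → ℝ
      h Z = f (Z ─ D)

      swapped : Subset n → Fin n → Fin n → Subset n
      swapped X x y = (X ─ ⁅ x ⁆) ∪ ⁅ y ⁆

      swap : Fin n → Subset n → Fin n → Subset n
      swap x X y =
        if does (x ∈? K) then X else
        if does (x ∈? X) then
          (if does (y ∈? X) then X else
           if does (indep? (swapped X x y)) then
             (if does (N · h (swapped X x y) ≤? N · h X + w) then X else swapped X x y)
           else X)
        else X

      sweep : Subset n → Subset n
      sweep X = foldl (λ Y x → foldl (swap x) Y (λ y → y)) X (λ x → x)

      search : Subset n → Subset n
      search = iter N sweep

    -- The two sides differ only in how the operands of the final comparison are computed, so
    -- congruence in its Boolean outcome is enough.
    eval-try-swap : ∀ {Γ} X D K w x y (γ : Environment Γ) →
                    eval (try-swap k X D K w x y) γ ≡ swap (γ D) (γ K) (γ w) (γ x) (γ X) (γ y)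
    eval-try-swap X D K w x y γ = cong (λ b →
        if does (γ x ∈? γ K) then γ X else
        if does (γ x ∈? γ X) then
          (if does (γ y ∈? γ X) then γ X else
           if does (indep? (swapped (γ D) (γ K) (γ w) (γ X) (γ x) (γ y))) then
             (if b then γ X else swapped (γ D) (γ K) (γ w) (γ X) (γ x) (γ y))
           else γ X)
        else γ X)
      (cong₂ (λ p q → does (p ≤? q + γ w))
        (trans (eval-scale (objective (insert y (remove x (var X))) D) γ)
          (cong (N ·_) (eval-objective (insert y (remove x (var X))) D γ)))
        (trans (eval-scale (objective (var X) D) γ) (cong (N ·_) (eval-objective (var X) D γ))))

    eval-local-search : ∀ {Γ} X D K w (γ : Environment Γ) →
                        eval (local-search k X D K w) γ ≡ search (γ D) (γ K) (γ w) (γ X)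
    eval-local-search X D K w γ = eval-rounds k (var X) _ γ (sweep (γ D) (γ K) (γ w)) λ a i b j v →
      foldl-cong (λ Y x → foldl-cong (λ Z y →
        eval-try-swap zero _ _ _ (suc (suc (suc zero))) (suc zero) (γ ▸ a ▸ i ▸ b ▸ j ▸ v ▸ x ▸ Y ▸ y ▸ Z)) Y (λ y → y)) v (λ x → x)

    module _ {D K : Subset n} {w : ℝ} (0≤w : 0# ≤ w) where
      Inv : Subset n → Set
      Inv X = IsBase X × K ⊆ X

      _≺_ : Subset n → Subset n → Set
      X ≺ Y = N · h D K w X + w ≤ N · h D K w Y

      Idle : Fin n → Fin n → Subset n → Set
      Idle x y X = x ∈ X → x ∉ K → y ∉ X → Indep (swapped D K w X x y) →
                   N · h D K w (swapped D K w X x y) ≤ N · h D K w X + w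

      ≺-trans : ∀ {X Y Z} → X ≺ Y → Y ≺ Z → X ≺ Z
      ≺-trans X≺Y Y≺Z = ≤-trans X≺Y (≤-trans (≤-trans (≤-reflexive (≈-sym (+-identityʳ _))) (+-mono-≤ ≤-refl 0≤w)) Y≺Z)

      swap-progress : ∀ x X y → Inv X → (swap D K w x X y ≡ X × Idle x y X) ⊎ (Inv (swap D K w x X y) × X ≺ swap D K w x X y)
      swap-progress x X y (baseX , K⊆X) with x ∈? K
      ... | yes x∈K = inj₁ (refl , λ _ x∉K → contradiction x∈K x∉K)
      ... | no  x∉K with x ∈? X
      ...   | no  x∉X = inj₁ (refl , λ x∈X → contradiction x∈X x∉X)
      ...   | yes x∈X with y ∈? X
      ...     | yes y∈X = inj₁ (refl , λ _ _ y∉X → contradiction y∈X y∉X)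
      ...     | no  y∉X with indep? (swapped D K w X x y)
      ...       | no  dep = inj₁ (refl , λ _ _ _ ind → contradiction ind dep)
      ...       | yes ind with N · h D K w (swapped D K w X x y) ≤? N · h D K w X + w
      ...         | yes le = inj₁ (refl , λ _ _ _ _ → le)
      ...         | no  gt = inj₂ ((exchanged-base baseX x∈X y∉X ind
                    , solve⊆ ((x₀ ⊑ x₁) ∷ (x₂ ⊓ x₀ ⊑ ø) ∷ []) x₀ ((x₁ ∖ x₂) ⊔ x₃)
                        (K ∷ X ∷ ⁅ x ⁆ ∷ ⁅ y ⁆ ∷ []) (K⊆X ∷ ∉⇒⁅⁆∩⊆⊥ x∉K ∷ [])) , <⇒≤ gt)

      sweep-progress : ∀ X → Inv X → (sweep D K w X ≡ X × (∀ x y → Idle x y X)) ⊎ (Inv (sweep D K w X) × X ≺ sweep D K w X)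
      sweep-progress X = foldl-progress {Inv = Inv} {Idle = λ x X → ∀ y → Idle x y X} {_≺_ = _≺_} ≺-trans
        (λ X x → foldl-progress {Inv = Inv} {Idle = Idle x} {_≺_ = _≺_} ≺-trans (swap-progress x) X (λ y → y)) X (λ x → x)

      Progress : ℕ → Subset n → Subset n → Set
      Progress j X Y = Inv Y × ((∀ x y → Idle x y Y) ⊎ (N · h D K w X + j · w ≤ N · h D K w Y))

      iter-progress : ∀ j X → Inv X → Progress j X (iter j (sweep D K w) X)
      iter-progress zero    X inv = inv , inj₂ (≤-reflexive (+-identityʳ _))
      iter-progress (suc j) X inv with sweep-progress X inv
      -- A set left alone by one sweep is a fixed point, so all remaining sweeps return it too.
      ... | inj₁ (eq , idle) = subst (Progress (suc j) X) (sym (iter-fixed (suc j) eq)) (inv , inj₁ idle)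
      ... | inj₂ (inv′ , X≺) with iter-progress j (sweep D K w X) inv′
      ...   | inv″ , inj₁ idle = inv″ , inj₁ idle
      ...   | inv″ , inj₂ le   = inv″ , inj₂ (≤-trans
        (≤-reflexive (≈-sym (+-assoc _ w (j · w)))) (≤-trans (+-mono-≤ X≺ ≤-refl) le))

      -- N sweeps that all increase the scaled objective by w bring it to N · w,
      -- which no independent set exceeds, so that no swap gains anything.
      search-optimal : NonNegative f → (∀ {I} → Indep I → f I ≤ w) → ∀ {X} → IsBase X → K ⊆ X →
        IsBase (search D K w X) × K ⊆ search D K w X × LocalOptimum (h D K w) K (fromℕ N) w (search D K w X)
      search-optimal nonneg bound {X} baseX K⊆X with iter-progress N X (baseX , K⊆X)
      ... | (base , K⊆) , reached = base , K⊆ , optimum reached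
        where
        Y = search D K w X
        optimum : (∀ x y → Idle x y Y) ⊎ (N · h D K w X + N · w ≤ N · h D K w Y) →
                  LocalOptimum (h D K w) K (fromℕ N) w Y
        optimum (inj₁ idle) x∈ x∉ y∉ ind = ≤-trans (≤-reflexive (≈-sym (·≈* N _)))
          (≤-trans (idle _ _ x∈ x∉ y∉ ind) (≤-reflexive (+-cong (·≈* N _) ≈-refl)))
        optimum (inj₂ le) {x} {y} x∈ x∉ y∉ ind = begin
          fromℕ N * h D K w Z           ≤⟨ *-monoˡ-≤ (0≤fromℕ N) (bound (hereditary (p─q⊆p Z D) ind)) ⟩
          fromℕ N * w                   ≈⟨ ·≈* N w ⟨
          N · w                         ≈⟨ +-identityˡ _ ⟨
          0# + N · w                    ≤⟨ +-mono-≤ (·-nonNegative N (nonneg _)) ≤-refl ⟩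
          N · h D K w X + N · w         ≤⟨ le ⟩
          N · h D K w Y                 ≈⟨ ≈-trans (≈-sym (+-identityʳ _)) (+-cong (·≈* N _) ≈-refl) ⟩
          fromℕ N * h D K w Y + 0#      ≤⟨ +-mono-≤ ≤-refl 0≤w ⟩
          fromℕ N * h D K w Y + w       ∎
          where
          open ≤-Reasoning
          Z = swapped D K w Y x y

  -- An element rejected at an early stage stays rejected: by heredity, being dependent together
  -- with `S` means being dependent together with any larger `G`. Hence a single pass yields a
  -- maximal set.
  foldl-greedy : ∀ {m} S (xs : Vector (Fin n) m) → Indep S →
    let G = foldl (λ v i → if does (indep? (v ∪ ⁅ i ⁆)) then v ∪ ⁅ i ⁆ else v) S xs
    in Indep G × S ⊆ G × (∀ i → Indep (G ∪ ⁅ xs i ⁆) → xs i ∈ G)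
  foldl-greedy {zero}  S xs ind = ind , (λ x∈ → x∈) , λ ()
  foldl-greedy {suc m} S xs ind with indep? (S ∪ ⁅ xs zero ⁆)
  ... | yes ind′ with indG , S⊆G , maximal ← foldl-greedy (S ∪ ⁅ xs zero ⁆) (λ i → xs (suc i)) ind′ =
    indG , (λ x∈S → S⊆G (p⊆p∪q _ x∈S)) , λ
      { zero _ → S⊆G (q⊆p∪q S _ (x∈⁅x⁆ _)) ; (suc i) → maximal i }
  ... | no dep with indG , S⊆G , maximal ← foldl-greedy S (λ i → xs (suc i)) ind =
    indG , S⊆G , λ
      { zero ind′ → contradiction (hereditary (solve⊆ ((x₀ ⊑ x₁) ∷ []) (x₀ ⊔ x₂) (x₁ ⊔ x₂) (S ∷ _ ∷ ⁅ xs zero ⁆ ∷ []) (S⊆G ∷ [])) ind′) dep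
      ; (suc i) → maximal i }

  greedy-is-base : ∀ {Γ} (γ : Environment Γ) → IsBase (eval greedy-base γ)
  greedy-is-base γ with indG , _ , maximal ← foldl-greedy ⊥ (λ i → i) ⊥-indep =
    indG , λ T indT G⊆T → ⊆-antisym
      (λ {x} x∈T → maximal x (hereditary (λ y∈ → [ G⊆T , (λ y∈⁅x⁆ → ∈⇒⁅⁆⊆ x∈T y∈⁅x⁆) ]′ (x∈p∪q⁻ _ ⁅ x ⁆ y∈)) indT)) G⊆T
    where open import Data.Sum.Base using ([_,_]′)

  module _ (nonneg : NonNegative f) (sub : Submodular f) where

    weigh : ℝ → Fin n → ℝ
    weigh a i = if does (indep? (⊥ ∪ ⁅ i ⁆)) then a + f (⊥ ∪ ⁅ i ⁆) else a

    ≤+nonneg : ∀ a S → a ≤ a + f S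
    ≤+nonneg a S = ≤-trans (≤-reflexive (≈-sym (+-identityʳ a))) (+-mono-≤ ≤-refl (nonneg S))

    weigh-≥ : ∀ a i → a ≤ weigh a i
    weigh-≥ a i with does (indep? (⊥ ∪ ⁅ i ⁆))
    ... | true  = ≤+nonneg a _
    ... | false = ≤-refl

    weigh-grown : ∀ {a I J x} → Indep I → x ∈ I → f J ≤ a → f (J ∪ (⊥ ∪ ⁅ x ⁆)) ≤ weigh a x
    weigh-grown {a} {I} {J} {x} indI x∈I fJ≤a with indep? (⊥ ∪ ⁅ x ⁆)
    ... | yes _   = ≤-trans (≤+nonneg _ _) (≤-trans (sub J (⊥ ∪ ⁅ x ⁆)) (+-mono-≤ fJ≤a ≤-refl))
    ... | no  dep = contradiction (hereditary
      (solve⊆ ((x₀ ⊑ x₁) ∷ []) (ø ⊔ x₀) x₁ (⁅ x ⁆ ∷ I ∷ []) (∈⇒⁅⁆⊆ x∈I ∷ [])) indI) dep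

    -- The set `J` is the part of `I` already met. By submodularity and non-negativity a new element
    -- of `I` raises f(J) by at most the value of its singleton, which the accumulator gains in the
    -- same step; elements outside `I` never lower the accumulator.
    foldl-weigh-≥ : ∀ {m} a (xs : Vector (Fin n) m) {I J} → Indep I → J ⊆ I → f J ≤ a →
      ∃[ J′ ] J ⊆ J′ × J′ ⊆ I × (∀ i → xs i ∈ I → xs i ∈ J′) × f J′ ≤ foldl weigh a xs
    foldl-weigh-≥ {zero}  a xs {J = J} indI J⊆I fJ≤a = J , (λ x∈ → x∈) , J⊆I , (λ ()) , fJ≤a
    foldl-weigh-≥ {suc m} a xs {I} {J} indI J⊆I fJ≤a with xs zero ∈? I
    ... | no  x∉I
      with J′ , J⊆J′ , J′⊆I , covers , le ← foldl-weigh-≥ (weigh a (xs zero)) (λ i → xs (suc i)) indI J⊆I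
                                              (≤-trans fJ≤a (weigh-≥ a (xs zero))) =
      J′ , J⊆J′ , J′⊆I , (λ { zero x∈I → contradiction x∈I x∉I ; (suc i) → covers i }) , le
    ... | yes x∈I
      with J′ , J+x⊆J′ , J′⊆I , covers , le ← foldl-weigh-≥ (weigh a (xs zero)) (λ i → xs (suc i)) {I} {J ∪ (⊥ ∪ ⁅ xs zero ⁆)} indI
               (solve⊆ ((x₀ ⊑ x₁) ∷ (x₂ ⊑ x₁) ∷ []) (x₀ ⊔ (ø ⊔ x₂)) x₁ (J ∷ I ∷ ⁅ xs zero ⁆ ∷ []) (J⊆I ∷ ∈⇒⁅⁆⊆ x∈I ∷ []))
               (weigh-grown indI x∈I fJ≤a) =
      J′ , (λ x∈ → J+x⊆J′ (p⊆p∪q _ x∈)) , J′⊆I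
      , (λ { zero _ → J+x⊆J′ (q⊆p∪q J _ (q⊆p∪q ⊥ _ (x∈⁅x⁆ (xs zero)))) ; (suc i) → covers i }) , le

    weight-bounds : ∀ {Γ} (γ : Environment Γ) {I} → Indep I → f I ≤ eval total-weight γ
    weight-bounds γ {I} indI
      with J , _ , J⊆I , covers , le ← foldl-weigh-≥ (f ⊥) (λ i → i) indI (λ x∈⊥ → contradiction x∈⊥ ∉⊥) ≤-refl =
      subst (λ J → f J ≤ _) (⊆-antisym J⊆I (λ {x} → covers x)) le

    foldl-weigh-≤ : ∀ {b} → (∀ {I} → Indep I → f I ≤ b) → ∀ {m} a (xs : Vector (Fin n) m) → foldl weigh a xs ≤ a + m · b
    foldl-weigh-≤ bound {zero}  a xs = ≤-reflexive (≈-sym (+-identityʳ a))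
    foldl-weigh-≤ {b} bound {suc m} a xs = ≤-trans (foldl-weigh-≤ bound (weigh a (xs zero)) (λ i → xs (suc i)))
      (≤-trans (+-mono-≤ weigh-≤ ≤-refl) (≤-reflexive (+-assoc a b (m · b))))
      where
      weigh-≤ : weigh a (xs zero) ≤ a + b
      weigh-≤ with indep? (⊥ ∪ ⁅ xs zero ⁆)
      ... | yes ind = +-mono-≤ ≤-refl (bound ind)
      ... | no  _   = ≤-trans (≤+nonneg a ⊥) (+-mono-≤ ≤-refl (bound ⊥-indep))

    weight-≤ : ∀ {Γ} (γ : Environment Γ) {b} → (∀ {I} → Indep I → f I ≤ b) → eval total-weight γ ≤ (1# + fromℕ n) * b
    weight-≤ γ {b} bound = ≤-trans (foldl-weigh-≤ bound (f ⊥) (λ i → i))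
      (≤-trans (+-mono-≤ (bound ⊥-indep) (≤-reflexive (·≈* n b)))
        (≤-reflexive (≈-sym (≈-trans (distribʳ b 1# (fromℕ n)) (+-cong (*-identityˡ b) ≈-refl)))))

    -- The set `I` extends to a base, and covering that base with kernel `I` gives bases `P`, `Q`
    -- with P ∩ Q = I, so that f(I) ≤ f(P) + f(Q). Without the disjoint bases the weight `w`, and
    -- with it the error, could not be measured against the optimum.
    independent-≤ : HasTwoDisjointBases → ∀ {m} → (∀ T → IsBase T → f T ≤ m) → ∀ {I} → Indep I → f I ≤ m + m
    independent-≤ disjoint@(A , _ , baseA , _) {m} bound {I} indI
      with Z , indZ , I⊆Z , _ , ∣Z∣ ← augment≤ indI (proj₁ baseA) (base-largest baseA indI)
      with P , Q , s , baseP , baseQ ← Spreading.spread disjoint (largest⇒base baseA indZ (ℕ.≤-reflexive (sym ∣Z∣))) I⊆Z = begin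
      f I                     ≡⟨ cong f (⊆-antisym (λ x∈ → x∈p∩q⁺ (K⊆P x∈ , K⊆Q x∈)) P∩Q⊆) ⟩
      f (P ∩ Q)               ≤⟨ ≤+nonneg _ (P ∪ Q) ⟩
      f (P ∩ Q) + f (P ∪ Q)   ≈⟨ +-comm _ _ ⟩
      f (P ∪ Q) + f (P ∩ Q)   ≤⟨ sub P Q ⟩
      f P + f Q               ≤⟨ +-mono-≤ (bound P baseP) (bound Q baseQ) ⟩
      m + m                   ∎
      where
      open ≤-Reasoning
      open Spreading.Spread s

    minus-submodular : ∀ D → Submodular (λ Z → f (Z ─ D))
    minus-submodular D S T = submodular-≤ {f} sub (S ─ D) (T ─ D)
      (solve≡ [] ((x₀ ∖ x₂) ⊔ (x₁ ∖ x₂)) ((x₀ ⊔ x₁) ∖ x₂) (S ∷ T ∷ D ∷ []) [])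
      (solve≡ [] ((x₀ ∖ x₂) ⊓ (x₁ ∖ x₂)) ((x₀ ⊓ x₁) ∖ x₂) (S ∷ T ∷ D ∷ []) [])

    module _ (k : ℕ) where
      open Search k

      local-search-optimal : ∀ {Γ} (X D K : Γ ∋ set) (w : Γ ∋ real) (γ : Environment Γ) →
        (∀ {I} → Indep I → f I ≤ γ w) → IsBase (γ X) → γ K ⊆ γ X →
        let Y = eval (local-search k X D K w) γ
        in IsBase Y × γ K ⊆ Y × LocalOptimum (λ Z → f (Z ─ γ D)) (γ K) (fromℕ N) (γ w) Y
      local-search-optimal X D K w γ bound baseX K⊆X =
        subst (λ Y → IsBase Y × γ K ⊆ Y × LocalOptimum (λ Z → f (Z ─ γ D)) (γ K) (fromℕ N) (γ w) Y)
          (sym (eval-local-search X D K w γ))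
          (search-optimal (≤-trans (nonneg ⊥) (bound ⊥-indep)) nonneg bound baseX K⊆X)

      module _ {S T X : Subset n} {w : ℝ} (0≤w : 0# ≤ w)
               (w≤ : ∀ {b} → (∀ {I} → Indep I → f I ≤ b) → w ≤ (1# + fromℕ n) * b)
               (baseS : IsBase S) (baseT : IsBase T) (baseX : IsBase X) (K⊆X : T ─ S ⊆ X)
               (optS : LocalOptimum (λ Z → f (Z ─ ⊥)) ⊥ (fromℕ N) w S)
               (optT : LocalOptimum (λ Z → f (Z ─ S)) ⊥ (fromℕ N) w T)
               (optX : LocalOptimum (λ Z → f (Z ─ ⊥)) (T ─ S) (fromℕ N) w X) where

        -- One search procedure serves both objectives, f and f(· ─ S), so the plain one appears as
        -- f(· ─ ⊥).
        minus⊥ : ∀ Z {b} → f Z ≤ b → f (Z ─ ⊥) ≤ b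
        minus⊥ Z = subst (λ Z → f Z ≤ _) (sym (p─⊥≡p Z))

        -- `C` is cut into C ∩ S and C ─ S, and C ─ S is the intersection of S ∪ C with (T ∪ C) ─ S.
        -- Submodularity is applied to both splittings; f(∅) and the value of the union are dropped
        -- as non-negative.
        optimum-covered : ∀ {C} → f C ≤ (f ((S ∪ C) ─ ⊥) + f ((S ∩ C) ─ ⊥)) + f ((T ∪ C) ─ S)
        optimum-covered {C} = linear
          (+-mono-≤ (+-mono-≤ inside-outside disjoint-parts) (+-mono-≤ (nonneg ⊥) (nonneg _)))
          (solve 7 (λ c e d g u₁ u₂ v₁ → c :+ (((d :+ u₂) :+ (u₁ :+ v₁)) :+ (e :+ g))
                    := ((u₁ :+ u₂) :+ v₁) :+ (((c :+ e) :+ (g :+ d)) :+ (con 0 :+ con 0)))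
            ≈-refl (f C) (f ⊥) (f (C ─ S)) (f U) (f ((S ∪ C) ─ ⊥)) (f ((S ∩ C) ─ ⊥)) (f ((T ∪ C) ─ S)))
          where
          U = ((S ∪ C) ─ ⊥) ∪ ((T ∪ C) ─ S)
          sets = S ∷ T ∷ C ∷ []
          inside-outside : f C + f ⊥ ≤ f (C ─ S) + f ((S ∩ C) ─ ⊥)
          inside-outside = submodular-≤ {f} sub (C ─ S) ((S ∩ C) ─ ⊥)
            (solve≡ [] ((x₂ ∖ x₀) ⊔ ((x₀ ⊓ x₂) ∖ ø)) x₂ sets [])
            (solve≡ [] ((x₂ ∖ x₀) ⊓ ((x₀ ⊓ x₂) ∖ ø)) ø sets [])
          disjoint-parts : f U + f (C ─ S) ≤ f ((S ∪ C) ─ ⊥) + f ((T ∪ C) ─ S)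
          disjoint-parts = submodular-≤ {f} sub ((S ∪ C) ─ ⊥) ((T ∪ C) ─ S) refl
            (solve≡ [] (((x₀ ⊔ x₂) ∖ ø) ⊓ ((x₁ ⊔ x₂) ∖ x₀)) (x₂ ∖ x₀) sets [])

        -- The sets X ∪ P and X ∪ Q meet in `X`, because P ∩ Q ⊆ K ⊆ X. The sets X ∩ P and X ∩ Q
        -- have union `X`, because `P` and `Q` cover it, and intersection `K`. Two uses of
        -- submodularity thus produce f(X) twice and f(K) once, besides the value of a union that is
        -- dropped.
        kernel-covered : ∀ {P Q} → Spreading.Spread {T ─ S} X P Q →
          f (T ─ S) + (f (X ─ ⊥) + f (X ─ ⊥))
            ≤ (f ((X ∪ P) ─ ⊥) + f ((X ∩ P) ─ ⊥)) + (f ((X ∪ Q) ─ ⊥) + f ((X ∩ Q) ─ ⊥))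
        kernel-covered {P} {Q} s = linear (+-mono-≤ (+-mono-≤ joins meets) (nonneg U))
          (solve 7 (λ t x g p₁ p₂ q₁ q₂ → t :+ (x :+ x) :+ (((p₁ :+ q₁) :+ (p₂ :+ q₂)) :+ g)
                    := ((p₁ :+ p₂) :+ (q₁ :+ q₂)) :+ (((g :+ x) :+ (x :+ t)) :+ con 0))
            ≈-refl (f (T ─ S)) (f (X ─ ⊥)) (f U) (f ((X ∪ P) ─ ⊥)) (f ((X ∩ P) ─ ⊥)) (f ((X ∪ Q) ─ ⊥)) (f ((X ∩ Q) ─ ⊥)))
          where
          open Spreading.Spread s
          U = ((X ∪ P) ─ ⊥) ∪ ((X ∪ Q) ─ ⊥)
          sets = X ∷ P ∷ Q ∷ (T ─ S) ∷ []
          hyps = (x₃ ⊑ x₀) ∷ (x₃ ⊑ x₁) ∷ (x₃ ⊑ x₂) ∷ (x₁ ⊓ x₂ ⊑ x₃) ∷ (x₀ ⊑ x₁ ⊔ x₂) ∷ []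
          facts = K⊆X ∷ K⊆P ∷ K⊆Q ∷ P∩Q⊆ ∷ X⊆ ∷ []
          joins : f U + f (X ─ ⊥) ≤ f ((X ∪ P) ─ ⊥) + f ((X ∪ Q) ─ ⊥)
          joins = submodular-≤ {f} sub ((X ∪ P) ─ ⊥) ((X ∪ Q) ─ ⊥) refl
            (solve≡ hyps (((x₀ ⊔ x₁) ∖ ø) ⊓ ((x₀ ⊔ x₂) ∖ ø)) (x₀ ∖ ø) sets facts)
          meets : f (X ─ ⊥) + f (T ─ S) ≤ f ((X ∩ P) ─ ⊥) + f ((X ∩ Q) ─ ⊥)
          meets = submodular-≤ {f} sub ((X ∩ P) ─ ⊥) ((X ∩ Q) ─ ⊥)
            (solve≡ hyps (((x₀ ⊓ x₁) ∖ ø) ⊔ ((x₀ ⊓ x₂) ∖ ø)) (x₀ ∖ ø) sets facts)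
            (solve≡ hyps (((x₀ ⊓ x₁) ∖ ø) ⊓ ((x₀ ⊓ x₂) ∖ ø)) x₃ sets facts)

        1≤fromℕ-≢0 : ∀ {j} → j ≢ 0 → 1# ≤ fromℕ j
        1≤fromℕ-≢0 {zero}  0≢0 = contradiction refl 0≢0
        1≤fromℕ-≢0 {suc j} _   = 1≤fromℕ j

        ratio : HasTwoDisjointBases → 1 ℕ.≤ k → ∀ {ε} → fromℕ 4 ≤ k · ε →
          ∀ m → IsMaximumOver IsBase f m → (fromℕ 6 ⁻¹ - ε) * m ≤ f (better S X)
        ratio disjoint 1≤k {ε} 4≤kε m ((C , baseC , fC≈m) , maximal) = answer (n ℕ.≟ 0)
          where
          0<k : 0# < fromℕ k
          0<k = 0<1≤ (1≤fromℕ-≢0 (ℕ.>⇒≢ 1≤k))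

          4≤κε : fromℕ 4 ≤ fromℕ k * ε
          4≤κε = ≤-trans 4≤kε (≤-reflexive (·≈* k ε))

          0≤m : 0# ≤ m
          0≤m = ≤-trans (nonneg C) (≤-reflexive fC≈m)

          answer : Dec (n ≡ 0) → (fromℕ 6 ⁻¹ - ε) * m ≤ f (better S X)
          -- For n = 0 the scaling factor k n² vanishes and the scaled inequalities carry no
          -- information, but there is only one subset. The arithmetic is reused with `c` set to 1,
          -- no error, and every value equal to the optimum.
          answer (yes n≡0) = ratio-bound {s = m} {t = m} {x = m} {w = 0#} {ν = fromℕ k} {c = 1#} {κ = fromℕ k}
                               {u₁ = m} {m} {m} {m} {m} {m} {m} {m}
              0<k 0≤m 0≤m ≤-refl
              (≈-sym (≈-trans (*-congˡ (*-identityˡ 1#)) (*-identityʳ _))) 4≤κε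
              (linear (+-mono-≤ 0≤m 0≤m) (solve 1 (λ m → m :+ (m :+ m) := ((m :+ m) :+ m) :+ (con 0 :+ con 0)) ≈-refl m))
              (linear 0≤m (solve 1 (λ m → (m :+ (m :+ m)) :+ m := ((m :+ m) :+ (m :+ m)) :+ con 0) ≈-refl m))
              same same same same
              (linear (+-mono-≤ (+-mono-≤ 0≤m 0≤m) (+-mono-≤ 0≤m 0≤m))
                (solve 1 (λ m → con 0 :+ ((m :+ m) :+ (m :+ m)) := (con 1 :+ con 1) :* (m :+ m) :+ ((con 0 :+ con 0) :+ (con 0 :+ con 0))) ≈-refl m))
              m≤best m≤best
            where
            same : fromℕ k * (m + m) ≤ fromℕ k * (m + m) + 1# * 0#
            same = ≤-reflexive (≈-sym (≈-trans (+-congˡ (zeroʳ 1#)) (+-identityʳ _)))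
            m≤best : m ≤ f (better S X)
            m≤best = ≤-reflexive (≈-trans (≈-sym fC≈m) (≈-reflexive (cong f (subset-unique n≡0 C (better S X)))))
          answer (no n≢0)
            with P , Q , s , baseP , baseQ ← Spreading.spread disjoint baseX K⊆X =
            ratio-bound 0<N 0≤m (nonneg ((T ∩ C) ─ S)) (1≤fromℕ-≢0 n≢0) N≈ 4≤κε
              (≤-trans (≤-reflexive (≈-sym fC≈m)) optimum-covered)
              (kernel-covered s)
              (local-optimum-≤ (minus-submodular ⊥) (0≤fromℕ N) 0≤w baseS ⊥⊆ optS baseC ⊥⊆)
              (local-optimum-≤ (minus-submodular S) (0≤fromℕ N) 0≤w baseT ⊥⊆ optT baseC ⊥⊆)
              (local-optimum-≤ (minus-submodular ⊥) (0≤fromℕ N) 0≤w baseX K⊆X optX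
                baseP (Spreading.Spread.K⊆P s))
              (local-optimum-≤ (minus-submodular ⊥) (0≤fromℕ N) 0≤w baseX K⊆X optX
                baseQ (Spreading.Spread.K⊆Q s))
              (w≤ (independent-≤ disjoint maximal))
              (minus⊥ S (proj₁ (better-≥ S X))) (minus⊥ X (proj₂ (better-≥ S X)))
            where
            1≤c : 1# ≤ fromℕ n
            1≤c = 1≤fromℕ-≢0 n≢0
            N≈ : fromℕ N ≈ fromℕ k * (fromℕ n * fromℕ n)
            N≈ = ≈-trans (fromℕ-* k (n ℕ.* n)) (*-congˡ (fromℕ-* n n))
            0<N : 0# < fromℕ N
            0<N N≤0 = *-positive 0<k (*-positive (0<1≤ 1≤c) (0<1≤ 1≤c)) (≤-trans (≤-reflexive (≈-sym N≈)) N≤0)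

      algorithm-guarantee : HasTwoDisjointBases → 1 ℕ.≤ k → ∀ {ε} → fromℕ 4 ≤ k · ε →
        IsBase (eval (algorithm k) (λ ())) ×
        (∀ m → IsMaximumOver IsBase f m → (fromℕ 6 ⁻¹ - ε) * m ≤ f (eval (algorithm k) (λ ())))
      algorithm-guarantee disjoint 1≤k 4≤kε =
          better-preserves {S} {X} (proj₁ optS) (proj₁ optX)
        , ratio {S} {T} {X} {w} (≤-trans (nonneg ⊥) (bound ⊥-indep)) (weight-≤ {[]} (λ ()))
            (proj₁ optS) (proj₁ optT) (proj₁ optX) (proj₁ optX′)
            (proj₂ (proj₂ optS)) (proj₂ (proj₂ optT)) (proj₂ optX′)
            disjoint 1≤k 4≤kε
        where
        γ₁ : Environment (real ∷ [])
        γ₁ = (λ ()) ▸ eval {[]} total-weight (λ ())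
        γ₃ = γ₁ ▸ eval greedy-base γ₁ ▸ ⊥
        w = γ₁ zero
        bound : ∀ {I} → Indep I → f I ≤ w
        bound = weight-bounds {[]} (λ ())

        S = eval (local-search k (suc zero) zero zero (suc (suc zero))) γ₃
        optS = local-search-optimal (suc zero) zero zero (suc (suc zero)) γ₃ bound (greedy-is-base γ₁) ⊥⊆
        γ₄ = γ₃ ▸ S
        T = eval (local-search k zero zero (suc zero) (suc (suc (suc zero)))) γ₄
        optT = local-search-optimal zero zero (suc zero) (suc (suc (suc zero))) γ₄ bound (proj₁ optS) ⊥⊆
        γ₅ = γ₄ ▸ T
        K = eval (set-difference zero (suc zero)) γ₅
        K≡ : K ≡ T ─ S
        K≡ = eval-set-difference zero (suc zero) γ₅
        γ₆ = γ₅ ▸ K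
        X = eval (local-search k (suc zero) (suc (suc (suc zero))) zero (suc (suc (suc (suc (suc zero)))))) γ₆
        optX = local-search-optimal (suc zero) (suc (suc (suc zero))) zero (suc (suc (suc (suc (suc zero))))) γ₆
                 bound (proj₁ optT) (λ x∈K → p─q⊆p T S (subst (_ ∈_) K≡ x∈K))
        optX′ = subst (λ K → K ⊆ X × LocalOptimum (λ Z → f (Z ─ ⊥)) K (fromℕ N) w X) K≡ (proj₂ optX)

theorem22 : (R : Reals) → let open Reals R in
    ∀ (ε : ℝ) → 0# < ε →
    ∃[ p ] PolyTimeApproximation R ((fromℕ 6) ⁻¹ - ε) p
theorem22 R ε 0<ε =
  program t , (λ n → cost t n ℕ.+ 1) , polynomial-+ (polynomial-cost t) (polynomial-const 1) ,
  λ M f disjoint nonneg sub →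
    let s , returns , s≤ = Correctness.returns-eval R M f t
        base , ratio     = Analysis.algorithm-guarantee R M f nonneg sub (suc k) disjoint (ℕ.s≤s ℕ.z≤n) 4≤[1+k]ε
    in eval R M f t (λ ()) , s , returns , s≤ , base , ratio
  where
  open OrderedField R
  open Evaluation using (eval)
  k = proj₁ (archimedean 0<ε (0≤fromℕ 4))
  -- The successor makes the parameter positive by construction, as the analysis demands; enlarging
  -- it preserves 4 ≤ k ε because ε is positive.
  t = algorithm (suc k)
  4≤[1+k]ε : fromℕ 4 ≤ suc k · ε
  4≤[1+k]ε = ≤-trans (proj₂ (archimedean 0<ε (0≤fromℕ 4))) (·-monoˡ-≤ (<⇒≤ 0<ε) (ℕ.n≤1+n k))
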